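{- Let $n$ and $r$ be positive integers with $n \ge 4$. Then $$\operatorname{mr}^-\left(P_n^r\right) = \begin{cases} n-r & \text{if } 1 \le r \le n-3 \text{ and } n-r \text{ is even},\\ n-r+1 & \text{if } 1 \le r \le n-3 \text{ and } n-r \text{ is odd},\\ 2 & \text{if } r \ge n-2.\end{cases}$$
   Context: All graphs are simple (finite, loopless, undirected). For a graph $G$ on vertex set $\{1,\dots,n\}$, let $\mathcal{S}^-(G)$ be the set of real $n\times n$ skew-symmetric matrices $A=[a_{ij}]$ (i.e. $A^T=-A$) such that for $i\neq j$, $a_{ij}\neq 0$ if and only if $ij$ is an edge of $G$. The minimum skew rank of $G$ is $\operatorname{mr}^-(G)=\min\{\operatorname{rank}(A): A\in\mathcal{S}^-(G)\}$. $P_n$ denotes the path with vertex set $\{1,\dots,n\}$ where $ij$ is an edge iff $|i-j|=1$. For a positive integer $r$, the power $G^r$ is the graph on the same vertex set in which distinct vertices $i,j$ are adjacent iff there is a walk in $G$ from $i$ to $j$ of length at most $r$; thus in $P_n^r$, distinct $i,j$ are adjacent iff $|i-j|\le r$. -}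

module Defs where

open import Level using (0ℓ)
open import Algebra.Bundles using (CommutativeRing)
open import Relation.Binary.Structures using (IsTotalOrder)
open import Data.Nat as ℕ using (ℕ; zero; suc; ∣_-_∣)
open import Data.Fin as Fin using (Fin; toℕ; punchIn)
open import Data.Product using (Σ; ∃; _×_; _,_)
open import Relation.Nullary using (¬_)
open import Relation.Binary.PropositionalEquality using (_≢_)

-- The real numbers, axiomatised as a Dedekind-complete ordered field.
-- (agda-stdlib has no reals; every model of this record is, classically,
-- isomorphic to ℝ, so quantifying over all models is stating the result
-- for ℝ.)

record RealField : Set₁ where
  field
    commRing : CommutativeRing 0ℓ 0ℓ
  open CommutativeRing commRing public
  field
    _≤ᵣ_        : Carrier → Carrier → Set
    isTotalOrder : IsTotalOrder _≈_ _≤ᵣ_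
    0≉1         : ¬ (0# ≈ 1#)
    inverse     : ∀ x → ¬ (x ≈ 0#) → Σ Carrier λ y → (x * y) ≈ 1#
    +-mono-≤    : ∀ {x y} z → x ≤ᵣ y → (x + z) ≤ᵣ (y + z)
    *-nonneg    : ∀ {x y} → 0# ≤ᵣ x → 0# ≤ᵣ y → 0# ≤ᵣ (x * y)
    completeness : (P : Carrier → Set) → ∃ P → (∃ λ b → ∀ x → P x → x ≤ᵣ b) →
                   ∃ λ s → (∀ x → P x → x ≤ᵣ s) ×
                           (∀ b → (∀ x → P x → x ≤ᵣ b) → s ≤ᵣ b)

Graph : ℕ → Set₁
Graph n = Fin n → Fin n → Set

pathPower : (n r : ℕ) → Graph n
pathPower n r i j = (i ≢ j) × (∣ toℕ i - toℕ j ∣ ℕ.≤ r)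

module Matrices (R : RealField) where
  open RealField R

  Matrix : ℕ → ℕ → Set
  Matrix m k = Fin m → Fin k → Carrier

  sumFin : ∀ {k} → (Fin k → Carrier) → Carrier
  sumFin {zero}  f = 0#
  sumFin {suc k} f = f Fin.zero + sumFin (λ i → f (Fin.suc i))

  sgn : ℕ → Carrier
  sgn zero    = 1#
  sgn (suc k) = - sgn k

  det : ∀ {k} → Matrix k k → Carrier
  det {zero}  A = 1#
  det {suc k} A = sumFin λ j →
    sgn (toℕ j) * (A Fin.zero j * det (λ a b → A (Fin.suc a) (punchIn j b)))

  Increasing : ∀ {k n} → (Fin k → Fin n) → Set
  Increasing f = ∀ a b → a Fin.< b → f a Fin.< f b

  HasNonzeroMinor : ∀ {n} → Matrix n n → ℕ → Set
  HasNonzeroMinor {n} A k =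
    Σ (Fin k → Fin n) λ f → Σ (Fin k → Fin n) λ g →
      Increasing f × Increasing g × ¬ (det (λ a b → A (f a) (g b)) ≈ 0#)

  RankIs : ∀ {n} → Matrix n n → ℕ → Set
  RankIs A k = HasNonzeroMinor A k × (∀ m → k ℕ.< m → ¬ HasNonzeroMinor A m)

  InSkew : ∀ {n} → Graph n → Matrix n n → Set
  InSkew G A =
    (∀ i j → A i j ≈ - A j i) ×
    (∀ i j → i ≢ j → ((¬ (A i j ≈ 0#) → G i j) × (G i j → ¬ (A i j ≈ 0#))))

  MinSkewRankIs : ∀ {n} → Graph n → ℕ → Set
  MinSkewRankIs G m =
    (Σ _ λ A → InSkew G A × RankIs A m) ×
    (∀ A k → InSkew G A → RankIs A k → m ℕ.≤ k)

{-# OPTIONS --safe #-}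

-- Put k = n − r. In a skew matrix A with the pattern of Pₙʳ the rows 1, …, k and
-- the columns r + 1, …, n meet in a lower triangular matrix with nonzero
-- diagonal, so rank A ≥ k. If k is odd, the skew matrix A[g,g] on the index set
-- g = {r + 1, …, n} has a nonzero kernel vector; if the rank were k, the columns
-- of A would be spanned by those in g, and the rows in g would be dependent,
-- which the triangular submatrix forbids. This gives rank A ≥ k + 1.
--
-- Conversely, for n ≤ 2q + r a matrix of rank at most 2q is obtained by adding,
-- for p < q, the skew form of rank two u ∧ u′ of plane vectors supported on the
-- r + 2 indices from 2p + 1 to 2p + r + 2. The vectors turn counterclockwise
-- through exactly half a circle, so that entries above the diagonal are positive
-- except the one for the two extreme, antiparallel vectors. All entries of the
-- band are then sums of nonnegative terms, one of which is positive.

module Submission where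

open import Defs
import Algebra.Solver.Ring as RingSolver
open import Algebra.Bundles using (RawRing; CommutativeMonoid)
open import Algebra.Solver.Ring.AlmostCommutativeRing using (fromCommutativeRing; _-Raw-AlmostCommutative⟶_)
import Algebra.Properties.Semiring.Mult as Mult
import Algebra.Properties.Semiring.Sum as Sum
import Algebra.Properties.Ring as RingProperties
open import Data.Nat as ℕ using (ℕ; zero; suc; z≤n; s≤s; ∣_-_∣)
import Data.Nat.Properties as ℕ
open import Data.Nat.Divisibility using (_∣_; divides)
open import Data.Fin as Fin using (Fin; zero; suc; toℕ; punchIn; punchOut; _↑ʳ_; inject≤; remQuot; combine; fromℕ; inject₁)
import Data.Fin.Properties as Fin
open import Data.Vec.Functional using (_∷_; insertAt)
open import Data.Vec.Functional.Properties using (insertAt-lookup; insertAt-punchIn)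
open import Data.Maybe using (Maybe; just; nothing)
open import Data.Product using (Σ; ∃; _×_; _,_; proj₁; proj₂)
open import Data.Sum using (_⊎_; inj₁; inj₂)
open import Function using (_∘_)
open import Relation.Nullary using (¬_; Dec; yes; no; contradiction)
open import Relation.Nullary.Decidable using (¬?; decidable-stable)
open import Relation.Binary.Structures using (IsTotalOrder)
open import Relation.Binary.Definitions using (tri<; tri≈; tri>)
open import Relation.Binary.PropositionalEquality as ≡ using (_≡_; _≢_)

module _ (R : RealField) where
  open RealField R hiding (_≤ᵣ_; zero)
  open RealField R using () renaming (_≤ᵣ_ to infix 4 _≤_)
  open Matrices R
  open Mult semiring using (×-homo-+; ×1-homo-*) renaming (_×_ to _·_)
  open RingProperties ring
  open import Relation.Binary.Reasoning.Setoid setoid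
  open IsTotalOrder isTotalOrder using (total; antisym; ≤-respˡ-≈; ≤-respʳ-≈)
    renaming (trans to ≤-trans; reflexive to ≤-reflexive; refl to ≤-refl)

  -- Integer coefficients for the ring solver.

  private
    -- The coefficient (m , n) stands for the integer m − n.
    cancel : ℕ → ℕ → ℕ × ℕ
    cancel (suc m) (suc n) = cancel m n
    cancel m       n       = m , n

    coefficients : RawRing _ _
    coefficients = record
      { Carrier = ℕ × ℕ
      ; _≈_ = _≡_
      ; _+_ = λ (a , b) (c , d) → cancel (a ℕ.+ c) (b ℕ.+ d)
      ; _*_ = λ (a , b) (c , d) → cancel (a ℕ.* c ℕ.+ b ℕ.* d) (a ℕ.* d ℕ.+ b ℕ.* c)
      ; -_  = λ (a , b) → b , a
      ; 0#  = 0 , 0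
      ; 1#  = 1 , 0
      }

    ⟦_⟧ : ℕ × ℕ → Carrier
    ⟦ a , b ⟧ = a · 1# - b · 1#

    -- Agrees with ⟦_⟧, but sends 0 and 1 to 0# and 1# on the nose, so that
    -- these constants may be used in solver goals.
    ⟦_⟧ᶜ : ℕ × ℕ → Carrier
    ⟦ 0 , 0 ⟧ᶜ = 0#
    ⟦ 1 , 0 ⟧ᶜ = 1#
    ⟦ x ⟧ᶜ     = ⟦ x ⟧

    ⟦_⟧ᶜ≈ : ∀ x → ⟦ x ⟧ᶜ ≈ ⟦ x ⟧
    ⟦ 0 , 0 ⟧ᶜ≈           = sym (-‿inverseʳ 0#)
    ⟦ 1 , 0 ⟧ᶜ≈           = sym (trans (+-cong (+-identityʳ 1#) -0#≈0#) (+-identityʳ 1#))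
    ⟦ suc (suc _) , 0 ⟧ᶜ≈ = refl
    ⟦ 0 , suc _ ⟧ᶜ≈       = refl
    ⟦ 1 , suc _ ⟧ᶜ≈       = refl
    ⟦ suc (suc _) , suc _ ⟧ᶜ≈ = refl

    open import Algebra.Properties.CommutativeSemigroup
      (CommutativeMonoid.commutativeSemigroup +-commutativeMonoid) using (interchange)

    sub-+ : ∀ a b c d → (a + c) - (b + d) ≈ (a - b) + (c - d)
    sub-+ a b c d = trans (+-congˡ (sym (-‿+-comm b d))) (interchange a c (- b) (- d))

    ⟦cancel⟧ : ∀ m n → ⟦ cancel m n ⟧ ≈ ⟦ m , n ⟧
    ⟦cancel⟧ zero    _       = refl
    ⟦cancel⟧ (suc _) zero    = refl
    ⟦cancel⟧ (suc m) (suc n) = trans (⟦cancel⟧ m n) (sym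
      (trans (sub-+ 1# 1# _ _) (trans (+-congʳ (-‿inverseʳ 1#)) (+-identityˡ _))))

    +-homo : ∀ x y → ⟦ RawRing._+_ coefficients x y ⟧ ≈ ⟦ x ⟧ + ⟦ y ⟧
    +-homo (a , b) (c , d) = trans (⟦cancel⟧ (a ℕ.+ c) (b ℕ.+ d)) (trans
      (+-cong (×-homo-+ 1# a c) (-‿cong (×-homo-+ 1# b d))) (sub-+ _ _ _ _))

    *-homo : ∀ x y → ⟦ RawRing._*_ coefficients x y ⟧ ≈ ⟦ x ⟧ * ⟦ y ⟧
    *-homo (a , b) (c , d) = begin
      ⟦ cancel (a ℕ.* c ℕ.+ b ℕ.* d) (a ℕ.* d ℕ.+ b ℕ.* c) ⟧
        ≈⟨ ⟦cancel⟧ (a ℕ.* c ℕ.+ b ℕ.* d) _ ⟩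
      (a ℕ.* c ℕ.+ b ℕ.* d) · 1# - (a ℕ.* d ℕ.+ b ℕ.* c) · 1#
        ≈⟨ +-cong (hom a c b d) (-‿cong (hom a d b c)) ⟩
      (A * C + B * D) - (A * D + B * C)
        ≈⟨ sub-+ _ _ _ _ ⟩
      (A * C - A * D) + (B * D - B * C)
        ≈⟨ +-cong (x[y-z]≈xy-xz A C D) (⁻¹-anti-homo-// (B * C) (B * D)) ⟨
      A * (C - D) + - (B * C - B * D)
        ≈⟨ +-congˡ (trans (-‿cong (sym (x[y-z]≈xy-xz B C D))) (-‿distribˡ-* B (C - D))) ⟩
      A * (C - D) + - B * (C - D)
        ≈⟨ distribʳ (C - D) A (- B) ⟨
      (A - B) * (C - D) ∎
      where
      A = a · 1# ; B = b · 1# ; C = c · 1# ; D = d · 1#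
      hom : ∀ a c b d → (a ℕ.* c ℕ.+ b ℕ.* d) · 1# ≈ (a · 1#) * (c · 1#) + (b · 1#) * (d · 1#)
      hom a c b d = trans (×-homo-+ 1# (a ℕ.* c) (b ℕ.* d)) (+-cong (×1-homo-* a c) (×1-homo-* b d))

    morphism : coefficients -Raw-AlmostCommutative⟶ fromCommutativeRing commRing
    morphism = record
      { ⟦_⟧    = ⟦_⟧ᶜ
      ; +-homo = λ x y → trans ⟦ RawRing._+_ coefficients x y ⟧ᶜ≈ (trans (+-homo x y) (+-cong (sym ⟦ x ⟧ᶜ≈) (sym ⟦ y ⟧ᶜ≈)))
      ; *-homo = λ x y → trans ⟦ RawRing._*_ coefficients x y ⟧ᶜ≈ (trans (*-homo x y) (*-cong (sym ⟦ x ⟧ᶜ≈) (sym ⟦ y ⟧ᶜ≈)))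
      ; -‿homo = λ x@(a , b) → trans ⟦ b , a ⟧ᶜ≈
                   (trans (sym (⁻¹-anti-homo-// (a · 1#) (b · 1#))) (-‿cong (sym ⟦ x ⟧ᶜ≈)))
      ; 0-homo = refl
      ; 1-homo = refl
      }

    _≟ᶜ_ : ∀ x y → Maybe (⟦ x ⟧ᶜ ≈ ⟦ y ⟧ᶜ)
    x@(a , b) ≟ᶜ y@(c , d) with a ℕ.+ d ℕ.≟ c ℕ.+ b
    ... | no _  = nothing
    ... | yes e = just (trans ⟦ x ⟧ᶜ≈ (trans (x∙y⁻¹≈ε⇒x≈y _ _ (begin
      (A - B) - (C - D)       ≈⟨ trans (sub-+ A C (- B) (- D)) (+-congˡ (-‿+-comm B (- D))) ⟩
      (A - C) + - (B - D)     ≈⟨ +-congˡ (⁻¹-anti-homo-// B D) ⟩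
      (A - C) + (D - B)       ≈⟨ sub-+ A C D B ⟨
      (A + D) - (C + B)       ≈⟨ x≈y⇒x∙y⁻¹≈ε (begin
        A + D                   ≈⟨ ×-homo-+ 1# a d ⟨
        (a ℕ.+ d) · 1#          ≡⟨ ≡.cong (_· 1#) e ⟩
        (c ℕ.+ b) · 1#          ≈⟨ ×-homo-+ 1# c b ⟩
        C + B                   ∎) ⟩
      0#                      ∎)) (sym ⟦ y ⟧ᶜ≈)))
      where
      A = a · 1# ; B = b · 1# ; C = c · 1# ; D = d · 1#

  open RingSolver coefficients (fromCommutativeRing commRing) morphism _≟ᶜ_ public
    using (solve; _:+_; _:*_; _:-_; :-_; _:=_; con)

  𝟘 𝟙 : ∀ {n} → RingSolver.Polynomial coefficients (fromCommutativeRing commRing) morphism _≟ᶜ_ n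
  𝟘 = con (0 , 0)
  𝟙 = con (1 , 0)

  -- Order of the field and decidability of vanishing.

  0≤1 : 0# ≤ 1#
  0≤1 with total 0# 1#
  ... | inj₁ p = p
  ... | inj₂ p = ≤-respʳ-≈ (solve 0 (:- 𝟙 :* :- 𝟙 := 𝟙) refl) (*-nonneg 0≤-1 0≤-1)
    where
    0≤-1 : 0# ≤ - 1#
    0≤-1 = ≤-respˡ-≈ (-‿inverseʳ 1#) (≤-respʳ-≈ (+-identityˡ _) (+-mono-≤ (- 1#) p))

  1≰0 : ¬ 1# ≤ 0#
  1≰0 p = 0≉1 (antisym 0≤1 p)

  1≤1+1 : 1# ≤ (1# + 1#)
  1≤1+1 = ≤-respˡ-≈ (+-identityˡ 1#) (+-mono-≤ 1# 0≤1)

  1+1≉0 : ¬ 1# + 1# ≈ 0#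
  1+1≉0 e = 1≰0 (≤-respʳ-≈ e 1≤1+1)

  -- The supremum s of {0} ∪ {2 | Q} is compared with 1.
  weak-excluded-middle : (Q : Set) → ¬ Q ⊎ ¬ ¬ Q
  weak-excluded-middle Q
    with completeness (λ x → x ≈ 0# ⊎ (x ≈ 1# + 1# × Q)) (0# , inj₁ refl)
           (1# + 1# , λ { _ (inj₁ e) → ≤-respˡ-≈ (sym e) (≤-trans 0≤1 1≤1+1)
                        ; _ (inj₂ (e , _)) → ≤-reflexive e })
  ... | s , upper , least with total s 1#
  ... | inj₁ s≤1 = inj₁ λ q → 1≰0 (≤-respˡ-≈ (solve 1 (λ x → x :+ x :- x := x) refl 1#)
                     (≤-respʳ-≈ (-‿inverseʳ 1#)
                       (+-mono-≤ (- 1#) (≤-trans (upper _ (inj₂ (refl , q))) s≤1))))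
  ... | inj₂ 1≤s = inj₂ λ ¬q → 1≰0 (≤-trans 1≤s (least 0# λ
                     { _ (inj₁ e) → ≤-reflexive e
                     ; _ (inj₂ (_ , q)) → contradiction q ¬q }))

  -- If x ≈ 0 is not refutable then x lies below every positive ε; the set of
  -- elements with this property is closed under doubling, so its supremum s
  -- satisfies 2s ≤ s.
  ≤0-stable : ∀ {x} → ¬ ¬ (x ≈ 0#) → x ≤ 0#
  ≤0-stable {x} ¬¬x≈0 = ≤-trans (upper x x-small) s≤0
    where
    Small : Carrier → Set
    Small z = ∀ ε → ¬ ε ≤ 0# → z ≤ ε

    x-small : Small x
    x-small ε ε≰0 with total x ε
    ... | inj₁ p = p
    ... | inj₂ p = contradiction (λ e → ε≰0 (≤-respʳ-≈ e p)) ¬¬x≈0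

    sup = completeness Small (x , x-small) (1# , λ _ small → small 1# 1≰0)
    s = proj₁ sup
    upper = proj₁ (proj₂ sup)

    ½ = proj₁ (inverse (1# + 1#) 1+1≉0)

    halves : ∀ ε → ε * ½ + ε * ½ ≈ ε
    halves ε = trans
      (solve 2 (λ e h → e :* h :+ e :* h := e :* ((𝟙 :+ 𝟙) :* h)) refl ε ½)
      (trans (*-congˡ (proj₂ (inverse (1# + 1#) 1+1≉0))) (*-identityʳ ε))

    double-mono : ∀ {a b} → a ≤ b → (a + a) ≤ (b + b)
    double-mono {a} {b} p = ≤-trans (+-mono-≤ a p)
      (≤-respˡ-≈ (+-comm a b) (+-mono-≤ b p))

    s+s-small : Small (s + s)
    -- `ε * ½` is again positive, so it bounds every element of `Small` and hence the supremum `s`.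
    s+s-small ε ε≰0 = ≤-respʳ-≈ (halves ε) (double-mono (proj₂ (proj₂ sup) (ε * ½)
      λ z small → small (ε * ½) λ p → ε≰0
        (≤-respˡ-≈ (halves ε) (≤-respʳ-≈ (+-identityˡ 0#) (double-mono p)))))

    s≤0 : s ≤ 0#
    s≤0 = ≤-respˡ-≈ (solve 1 (λ s → s :+ s :- s := s) refl s)
      (≤-respʳ-≈ (-‿inverseʳ s) (+-mono-≤ (- s) (upper (s + s) s+s-small)))

  ≈0-stable : ∀ {x} → ¬ ¬ (x ≈ 0#) → x ≈ 0#
  ≈0-stable {x} ¬¬x≈0 = antisym (≤0-stable ¬¬x≈0)
    (≤-respˡ-≈ (-‿inverseˡ x) (≤-respʳ-≈ (+-identityˡ x) (+-mono-≤ x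
      (≤0-stable λ ¬e → ¬¬x≈0 λ e → ¬e (trans (-‿cong e) -0#≈0#)))))

  -- Weak excluded middle together with stability amounts to a decision. The searches for pivots and
  -- the case splits on vanishing entries below rely on it.
  ≈0? : ∀ x → Dec (x ≈ 0#)
  ≈0? x with weak-excluded-middle (x ≈ 0#)
  ... | inj₁ x≉0   = no x≉0
  ... | inj₂ ¬¬x≈0 = yes (≈0-stable ¬¬x≈0)

  *-cancel-≈0 : ∀ {x y} → ¬ x ≈ 0# → x * y ≈ 0# → y ≈ 0#
  *-cancel-≈0 {x} {y} x≉0 xy≈0 with inverse x x≉0
  ... | x⁻¹ , e = trans (sym (*-identityˡ y)) (trans (*-congʳ (sym e))
      (trans (solve 3 (λ x i y → x :* i :* y := i :* (x :* y)) refl x x⁻¹ y)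
      (trans (*-congˡ xy≈0) (zeroʳ x⁻¹))))

  *-≉0 : ∀ {x y} → ¬ x ≈ 0# → ¬ y ≈ 0# → ¬ x * y ≈ 0#
  *-≉0 x≉0 y≉0 e = y≉0 (*-cancel-≈0 x≉0 e)

  -‿≉0 : ∀ {x} → ¬ x ≈ 0# → ¬ - x ≈ 0#
  -‿≉0 {x} x≉0 e = x≉0 (trans (sym (-‿involutive x)) (trans (-‿cong e) -0#≈0#))

  x≈-x⇒x≈0 : ∀ {x} → x ≈ - x → x ≈ 0#
  x≈-x⇒x≈0 {x} e = *-cancel-≈0 1+1≉0
    (trans (trans (distribʳ x 1# 1#) (+-cong (*-identityˡ x) (*-identityˡ x)))
      (trans (+-congˡ e) (-‿inverseʳ x)))

  +-nonneg : ∀ {x y} → 0# ≤ x → 0# ≤ y → 0# ≤ (x + y)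
  +-nonneg {x} {y} 0≤x 0≤y = ≤-trans 0≤y (≤-respˡ-≈ (+-identityˡ y) (+-mono-≤ y 0≤x))

  nonneg-+-≈0ˡ : ∀ {x y} → 0# ≤ x → 0# ≤ y → x + y ≈ 0# → x ≈ 0#
  nonneg-+-≈0ˡ {x} {y} 0≤x 0≤y e = antisym
    (≤-respˡ-≈ (+-identityˡ x) (≤-respʳ-≈ (trans (+-comm y x) e) (+-mono-≤ x 0≤y))) 0≤x

  ·1-nonneg : ∀ m → 0# ≤ (m · 1#)
  ·1-nonneg zero    = ≤-refl
  ·1-nonneg (suc m) = +-nonneg 0≤1 (·1-nonneg m)

  suc·1≉0 : ∀ m → ¬ suc m · 1# ≈ 0#
  suc·1≉0 m e = 0≉1 (sym (nonneg-+-≈0ˡ 0≤1 (·1-nonneg m) e))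

  -- Finite sums

  -- sumFin computes on sums over Fin (suc n), which prevents the summand from
  -- being inferred by unification; an opaque copy does not.
  opaque
    ∑ : ∀ {n} → (Fin n → Carrier) → Carrier
    ∑ = sumFin

    ∑-zero : (f : Fin 0 → Carrier) → ∑ f ≈ 0#
    ∑-zero f = refl

    ∑-suc : ∀ {n} (f : Fin (suc n) → Carrier) → ∑ f ≈ f zero + ∑ (f ∘ suc)
    ∑-suc f = refl

    det-expand : ∀ {k} (A : Matrix (suc k) (suc k)) →
      det A ≈ ∑ λ j → sgn (toℕ j) * (A zero j * det (λ a b → A (suc a) (punchIn j b)))
    det-expand A = refl

    ∑≡sum : ∀ {n} (f : Fin n → Carrier) → ∑ f ≡ Sum.sum semiring f
    ∑≡sum {zero}  f = ≡.refl
    ∑≡sum {suc n} f = ≡.cong (f zero +_) (∑≡sum (f ∘ suc))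

  ∑-cong : ∀ {n} {f g : Fin n → Carrier} → (∀ i → f i ≈ g i) → ∑ f ≈ ∑ g
  ∑-cong {f = f} {g} e rewrite ∑≡sum f | ∑≡sum g = Sum.sum-cong-≋ semiring e

  ∑-≈0 : ∀ {n} {f : Fin n → Carrier} → (∀ i → f i ≈ 0#) → ∑ f ≈ 0#
  ∑-≈0 {n} {f} e rewrite ∑≡sum f = trans (Sum.sum-cong-≋ semiring e) (Sum.sum-replicate-zero semiring n)

  *-∑ : ∀ {n} a (f : Fin n → Carrier) → a * ∑ f ≈ ∑ λ i → a * f i
  *-∑ a f rewrite ∑≡sum f | ∑≡sum (λ i → a * f i) = Sum.*-distribˡ-sum semiring a f

  ∑-* : ∀ {n} (f : Fin n → Carrier) a → ∑ f * a ≈ ∑ λ i → f i * a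
  ∑-* f a rewrite ∑≡sum f | ∑≡sum (λ i → f i * a) = Sum.*-distribʳ-sum semiring a f

  ∑-linear : ∀ {n} a b (f g : Fin n → Carrier) →
    (∑ λ i → a * f i + b * g i) ≈ a * ∑ f + b * ∑ g
  ∑-linear a b f g = trans distrib-+ (+-cong (sym (*-∑ a f)) (sym (*-∑ b g)))
    where
    distrib-+ : (∑ λ i → a * f i + b * g i) ≈ ∑ (λ i → a * f i) + ∑ (λ i → b * g i)
    distrib-+ rewrite ∑≡sum (λ i → a * f i + b * g i) | ∑≡sum (λ i → a * f i) | ∑≡sum (λ i → b * g i)
      = Sum.∑-distrib-+ semiring (λ i → a * f i) (λ i → b * g i)

  ∑-swap : ∀ {m n} (f : Fin m → Fin n → Carrier) →
    (∑ λ i → ∑ λ j → f i j) ≈ (∑ λ j → ∑ λ i → f i j)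
  ∑-swap f = trans (nested f) (trans (Sum.∑-comm semiring f) (sym (nested λ j i → f i j)))
    where
    nested : ∀ {m n} (f : Fin m → Fin n → Carrier) →
      (∑ λ i → ∑ (f i)) ≈ Sum.sum semiring (λ i → Sum.sum semiring (f i))
    nested f = trans (∑-cong λ i → reflexive (∑≡sum (f i))) (reflexive (∑≡sum (λ i → Sum.sum semiring (f i))))

  ∑-remove : ∀ {n} p (f : Fin (suc n) → Carrier) → ∑ f ≈ f p + ∑ (f ∘ punchIn p)
  ∑-remove p f rewrite ∑≡sum f | ∑≡sum (f ∘ punchIn p) = Sum.sum-remove semiring f

  ∑≉0⇒∃ : ∀ {n} (f : Fin n → Carrier) → ¬ ∑ f ≈ 0# → ∃ λ i → ¬ f i ≈ 0#
  ∑≉0⇒∃ f Σ≉0 with Fin.any? (λ i → ¬? (≈0? (f i)))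
  ... | yes p = p
  ... | no ¬p = contradiction (∑-≈0 λ i → decidable-stable (≈0? (f i)) λ e → ¬p (i , e)) Σ≉0

  ∑-nonneg : ∀ {n} (f : Fin n → Carrier) → (∀ i → 0# ≤ f i) → 0# ≤ ∑ f
  ∑-nonneg {zero}  f 0≤f = ≤-reflexive (sym (∑-zero f))
  ∑-nonneg {suc n} f 0≤f = ≤-respʳ-≈ (sym (∑-suc f)) (+-nonneg (0≤f zero) (∑-nonneg _ (0≤f ∘ suc)))

  ∑-nonneg-≉0 : ∀ {n} (f : Fin n → Carrier) → (∀ i → 0# ≤ f i) →
    ∀ p → ¬ f p ≈ 0# → ¬ ∑ f ≈ 0#
  ∑-nonneg-≉0 {suc n} f 0≤f p fp≉0 e = fp≉0 (nonneg-+-≈0ˡ (0≤f p)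
    (∑-nonneg _ (0≤f ∘ punchIn p)) (trans (sym (∑-remove p f)) e))

  -- Determinants

  det-cong : ∀ {k} (A B : Matrix k k) → (∀ i j → A i j ≈ B i j) → det A ≈ det B
  det-cong {zero}  A B A≈B = refl
  det-cong {suc k} A B A≈B = trans (det-expand A) (trans
    (∑-cong λ j → *-congˡ (*-cong (A≈B zero j) (det-cong (λ a b → A (suc a) (punchIn j b)) _ λ a b → A≈B (suc a) (punchIn j b))))
    (sym (det-expand B)))

  det-minors≈0 : ∀ {k} (A : Matrix (suc k) (suc k)) →
    (∀ j → det (λ a b → A (suc a) (punchIn j b)) ≈ 0#) → det A ≈ 0#
  det-minors≈0 A e = trans (det-expand A)
    (∑-≈0 λ j → trans (*-congˡ (trans (*-congˡ (e j)) (zeroʳ _))) (zeroʳ _))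

  -- The expansion of a determinant along its first two rows x and y, with H
  -- the complementary minors as a function of the selected columns.
  expand₂ : ∀ {m} (x y : Fin (suc m) → Carrier) (H : Fin (suc m) → Fin m → Carrier) → Carrier
  expand₂ x y H = ∑ λ a → sgn (toℕ a) *
    (x a * ∑ λ b → sgn (toℕ b) * (y (punchIn a b) * H a b))

  expand₂-cong : ∀ {m} (x y : Fin (suc m) → Carrier) {H K : Fin (suc m) → Fin m → Carrier} →
    (∀ a b → H a b ≈ K a b) → expand₂ x y H ≈ expand₂ x y K
  expand₂-cong x y e = ∑-cong λ a → *-congˡ (*-congˡ (∑-cong λ b → *-congˡ (*-congˡ (e a b))))

  -- The terms are split by the row that takes column 0: `x`, `y` or neither. The hypothesis on `H`
  -- says that taking columns 0 and a + 1 in either order leaves the same complementary minor.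
  expand₂-peel : ∀ {m} (x y : Fin (suc (suc m)) → Carrier) (H : Fin (suc (suc m)) → Fin (suc m) → Carrier) →
    (∀ a → H (suc a) zero ≈ H zero a) →
    expand₂ x y H ≈
      ((∑ λ b → sgn (toℕ b) * (x zero * y (suc b) * H zero b)) -
       (∑ λ b → sgn (toℕ b) * (y zero * x (suc b) * H zero b)))
      + expand₂ (x ∘ suc) (y ∘ suc) (λ a b → H (suc a) (suc b))
  expand₂-peel x y H sym-H = trans (∑-suc _) (trans
    (+-cong first (trans (∑-cong later) (∑-linear (- 1#) 1# p q)))
    (solve 3 (λ s t u → s :+ (:- 𝟙 :* t :+ 𝟙 :* u) := s :- t :+ u) refl _ _ _))
    where
    inner = λ a → ∑ λ b → sgn (toℕ b) * (y (suc (punchIn a b)) * H (suc a) (suc b))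
    p = λ a → sgn (toℕ a) * (y zero * x (suc a) * H zero a)
    q = λ a → sgn (toℕ a) * (x (suc a) * inner a)

    first : 1# * (x zero * ∑ λ b → sgn (toℕ b) * (y (suc b) * H zero b))
          ≈ ∑ λ b → sgn (toℕ b) * (x zero * y (suc b) * H zero b)
    first = trans (*-identityˡ _) (trans (*-∑ (x zero) _) (∑-cong λ b →
      solve 4 (λ x s y h → x :* (s :* (y :* h)) := s :* (x :* y :* h)) refl
        (x zero) (sgn (toℕ b)) (y (suc b)) (H zero b)))

    negate : ∀ a → (∑ λ b → - sgn (toℕ b) * (y (suc (punchIn a b)) * H (suc a) (suc b)))
           ≈ - 1# * inner a
    negate a = trans (∑-cong λ b →
      solve 2 (λ s t → :- s :* t := :- 𝟙 :* (s :* t)) refl (sgn (toℕ b)) (y (suc (punchIn a b)) * H (suc a) (suc b)))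
      (sym (*-∑ (- 1#) _))

    later : ∀ a → - sgn (toℕ a) * (x (suc a) *
              ∑ λ b → sgn (toℕ b) * (y (punchIn (suc a) b) * H (suc a) b))
            ≈ - 1# * p a + 1# * q a
    later a = trans (*-congˡ (*-congˡ (trans (∑-suc _) (+-cong (*-congˡ (*-congˡ (sym-H a))) (negate a)))))
      (solve 5 (λ s x y h i → :- s :* (x :* (𝟙 :* (y :* h) :+ :- 𝟙 :* i))
                  := :- 𝟙 :* (s :* (y :* x :* h)) :+ 𝟙 :* (s :* (x :* i))) refl
        (sgn (toℕ a)) (x (suc a)) (y zero) (H zero a) (inner a))

  -- After peeling, the two sums involving column 0 change places when `x` and `y` do, and cancel;
  -- the rest is treated by induction. The complementary minor is a function of the embedding of the
  -- remaining columns, required to respect pointwise equality of embeddings.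
  expand₂-antisym : ∀ {m} (x y : Fin (suc (suc m)) → Carrier)
    (H : (Fin m → Fin (suc (suc m))) → Carrier) → (∀ {φ ψ} → (∀ j → φ j ≡ ψ j) → H φ ≈ H ψ) →
    let K = λ a b → H (λ j → punchIn a (punchIn b j)) in
    expand₂ x y K + expand₂ y x K ≈ 0#
  expand₂-antisym {m} x y H H-ext = trans
    (+-cong (expand₂-peel x y K λ a → refl) (expand₂-peel y x K λ a → refl))
    (trans (solve 4 (λ s t u v → (s :- t :+ u) :+ (t :- s :+ v) := u :+ v) refl _ _ _ _) (tails m x y H H-ext))
    where
    K = λ a b → H (λ j → punchIn a (punchIn b j))

    tails : ∀ m (x y : Fin (suc (suc m)) → Carrier)
      (H : (Fin m → Fin (suc (suc m))) → Carrier) → (∀ {φ ψ} → (∀ j → φ j ≡ ψ j) → H φ ≈ H ψ) →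
      let K′ = λ a b → H (λ j → punchIn (suc a) (punchIn (suc b) j)) in
      expand₂ (x ∘ suc) (y ∘ suc) K′ + expand₂ (y ∘ suc) (x ∘ suc) K′ ≈ 0#
    tails zero x y H H-ext = trans (+-cong (vanish (x ∘ suc) (y ∘ suc)) (vanish (y ∘ suc) (x ∘ suc))) (+-identityˡ 0#)
      where
      vanish : ∀ x y {H : Fin 1 → Fin 0 → Carrier} → expand₂ x y H ≈ 0#
      vanish x y = ∑-≈0 λ a → trans (*-congˡ (trans (*-congˡ (∑-zero _)) (zeroʳ _))) (zeroʳ _)
    tails (suc m) x y H H-ext = trans
      (+-cong (expand₂-cong (x ∘ suc) (y ∘ suc) step) (expand₂-cong (y ∘ suc) (x ∘ suc) step))
      -- Neither row takes column 0 here, so it stays in the complementary minor as its first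
      -- column.
      (expand₂-antisym (x ∘ suc) (y ∘ suc) (λ φ → H (zero ∷ (suc ∘ φ)))
        λ e → H-ext λ { zero → ≡.refl ; (suc j) → ≡.cong suc (e j) })
      where
      step : ∀ a b → H (λ j → punchIn (suc a) (punchIn (suc b) j))
                   ≈ H (zero ∷ (suc ∘ λ j → punchIn a (punchIn b j)))
      step a b = H-ext λ { zero → ≡.refl ; (suc j) → ≡.refl }

  det-swap : ∀ {m} (x y : Fin (suc (suc m)) → Carrier) (A : Matrix m (suc (suc m))) →
    det (x ∷ (y ∷ A)) ≈ - det (y ∷ (x ∷ A))
  det-swap x y A = begin
    det (x ∷ (y ∷ A))  ≈⟨ det≈expand₂ x y ⟩
    expand₂ x y K      ≈⟨ solve 2 (λ s t → s := s :+ t :- t) refl _ (expand₂ y x K) ⟩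
    expand₂ x y K + expand₂ y x K - expand₂ y x K
      ≈⟨ +-congʳ (expand₂-antisym x y (λ φ → det λ a b → A a (φ b))
           λ {φ} {ψ} e → det-cong (λ a b → A a (φ b)) (λ a b → A a (ψ b)) λ a b → reflexive (≡.cong (A a) (e b))) ⟩
    0# - expand₂ y x K ≈⟨ +-identityˡ _ ⟩
    - expand₂ y x K    ≈⟨ -‿cong (det≈expand₂ y x) ⟨
    - det (y ∷ (x ∷ A)) ∎
    where
    K = λ a b → det λ i j → A i (punchIn a (punchIn b j))
    det≈expand₂ : ∀ x y → det (x ∷ (y ∷ A)) ≈ expand₂ x y K
    det≈expand₂ x y = trans (det-expand (x ∷ (y ∷ A))) (∑-cong λ a → *-congˡ (*-congˡ
      (det-expand (λ i j → (y ∷ A) i (punchIn a j)))))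

  -- Exchanging the first two rows suffices. If they are the equal ones, the determinant is its own
  -- negative; otherwise the exchange moves row 0 into all minors along the new first row, and these
  -- contain the repetition.
  det-repeated-row : ∀ {k} (A : Matrix (suc k) (suc k)) q →
    (∀ j → A zero j ≈ A (suc q) j) → det A ≈ 0#
  det-repeated-row {suc k} A q e = trans swapped (swapped≈0 q e)
    where
    A′ = A (suc zero) ∷ (A zero ∷ λ i → A (suc (suc i)))

    swapped : det A ≈ - det A′
    swapped = trans (det-cong A (A zero ∷ (A (suc zero) ∷ λ i → A (suc (suc i)))) λ { zero _ → refl ; (suc zero) _ → refl ; (suc (suc _)) _ → refl })
      (det-swap (A zero) (A (suc zero)) λ i → A (suc (suc i)))

    swapped≈0 : ∀ q → (∀ j → A zero j ≈ A (suc q) j) → - det A′ ≈ 0#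
    swapped≈0 zero    e = trans (sym swapped) (x≈-x⇒x≈0 (trans swapped (-‿cong
      (det-cong A′ A λ { zero j → sym (e j) ; (suc zero) j → e j ; (suc (suc _)) _ → refl }))))
    swapped≈0 (suc q) e = trans (-‿cong (det-minors≈0 A′ λ j →
      det-repeated-row (λ a b → A′ (suc a) (punchIn j b)) q λ b → e (punchIn j b))) -0#≈0#

  -- A nonzero vector v with vA = 0 writes a row as a combination of other rows.
  left-kernel⇒det≈0 : ∀ {k} (A : Matrix k k) (v : Fin k → Carrier) p → ¬ v p ≈ 0# →
    (∀ j → (∑ λ i → v i * A i j) ≈ 0#) → det A ≈ 0#
  left-kernel⇒det≈0 {suc k} A v p vp≉0 vA≈0 with ≈0? (v zero)
  ... | no v₀≉0 = *-cancel-≈0 v₀≉0 (begin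
    v zero * det A
      ≈⟨ trans (*-congˡ (det-expand A)) (*-∑ (v zero) _) ⟩
    (∑ λ j → v zero * (s j * (A zero j * M j)))
      ≈⟨ (∑-cong λ j → trans
           (solve 4 (λ v s a m → v :* (s :* (a :* m)) := v :* a :* (s :* m)) refl (v zero) (s j) (A zero j) (M j))
           (*-congʳ (first-row j))) ⟩
    (∑ λ j → (∑ λ i → - v (suc i) * A (suc i) j) * (s j * M j))
      ≈⟨ ∑-cong (λ j → ∑-* _ (s j * M j)) ⟩
    (∑ λ j → ∑ λ i → - v (suc i) * A (suc i) j * (s j * M j))
      ≈⟨ ∑-swap _ ⟩
    (∑ λ i → ∑ λ j → - v (suc i) * A (suc i) j * (s j * M j))
      ≈⟨ ∑-≈0 (λ i → begin
        (∑ λ j → - v (suc i) * A (suc i) j * (s j * M j))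
          ≈⟨ (∑-cong λ j →
               solve 4 (λ v s a m → v :* a :* (s :* m) := v :* (s :* (a :* m))) refl (- v (suc i)) (s j) (A (suc i) j) (M j)) ⟩
        (∑ λ j → - v (suc i) * (s j * (A (suc i) j * M j)))
          ≈⟨ *-∑ (- v (suc i)) _ ⟨
        - v (suc i) * (∑ λ j → s j * (A (suc i) j * M j))
          -- The sum expands the determinant in which row i + 1 has replaced row 0 and so occurs
          -- twice.
          ≈⟨ *-congˡ (trans (sym (det-expand (A (suc i) ∷ (A ∘ suc))))
               (det-repeated-row (A (suc i) ∷ (A ∘ suc)) i λ _ → refl)) ⟩
        - v (suc i) * 0#  ≈⟨ zeroʳ _ ⟩
        0#                ∎) ⟩
    0# ∎)
    where
    s = λ (j : Fin (suc k)) → sgn (toℕ j)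
    M = λ j → det (λ a b → A (suc a) (punchIn j b))
    first-row : ∀ j → v zero * A zero j ≈ ∑ λ i → - v (suc i) * A (suc i) j
    first-row j = begin
      v zero * A zero j
        ≈⟨ solve 2 (λ x y → x := x :+ y :- y) refl _ (∑ λ i → v (suc i) * A (suc i) j) ⟩
      v zero * A zero j + (∑ λ i → v (suc i) * A (suc i) j) - (∑ λ i → v (suc i) * A (suc i) j)
        ≈⟨ +-congʳ (trans (sym (∑-suc _)) (vA≈0 j)) ⟩
      0# - (∑ λ i → v (suc i) * A (suc i) j)
        ≈⟨ solve 1 (λ y → 𝟘 :- y := :- 𝟙 :* y) refl _ ⟩
      - 1# * (∑ λ i → v (suc i) * A (suc i) j)
        ≈⟨ *-∑ (- 1#) _ ⟩
      (∑ λ i → - 1# * (v (suc i) * A (suc i) j))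
        ≈⟨ (∑-cong λ i → solve 2 (λ v a → :- 𝟙 :* (v :* a) := :- v :* a) refl (v (suc i)) (A (suc i) j)) ⟩
      (∑ λ i → - v (suc i) * A (suc i) j) ∎
  ... | yes v₀≈0 with p
  ...   | zero  = contradiction v₀≈0 vp≉0
  ...   | suc p = det-minors≈0 A λ j → left-kernel⇒det≈0 (λ a b → A (suc a) (punchIn j b)) (v ∘ suc) p vp≉0
          λ b → trans (sym (trans (∑-suc _) (trans (+-congʳ (trans (*-congʳ v₀≈0) (zeroˡ _))) (+-identityˡ _))))
                  (vA≈0 (punchIn j b))

  det-lower-triangular≉0 : ∀ {k} (A : Matrix k k) → (∀ i j → i Fin.< j → A i j ≈ 0#) →
    (∀ i → ¬ A i i ≈ 0#) → ¬ det A ≈ 0#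
  det-lower-triangular≉0 {zero}  A A≈0 A≉0 e = 0≉1 (sym e)
  det-lower-triangular≉0 {suc k} A A≈0 A≉0 e = *-≉0 (A≉0 zero)
    (det-lower-triangular≉0 (λ i j → A (suc i) (suc j))
      (λ i j i<j → A≈0 (suc i) (suc j) (s≤s i<j)) (A≉0 ∘ suc))
    (begin
      x                 ≈⟨ solve 1 (λ x → x := 𝟙 :* x :+ 𝟘) refl x ⟩
      1# * x + 0#       ≈⟨ +-congˡ (∑-≈0 λ j → trans (*-congˡ (trans (*-congʳ (A≈0 zero (suc j) (s≤s z≤n))) (zeroˡ _))) (zeroʳ _)) ⟨
      1# * x + ∑ _      ≈⟨ ∑-suc _ ⟨
      ∑ _               ≈⟨ det-expand A ⟨
      det A             ≈⟨ e ⟩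
      0#                ∎)
    where x = A zero zero * det (λ i j → A (suc i) (suc j))

  -- Induction on the size: a minor that omits a column other than column 0 still has column 0 as
  -- its first column.
  det-column-linear : ∀ {k} s t (A B C : Matrix (suc k) (suc k)) →
    (∀ i → A i zero ≈ s * B i zero + t * C i zero) →
    (∀ i j → A i (suc j) ≈ B i (suc j)) → (∀ i j → A i (suc j) ≈ C i (suc j)) →
    det A ≈ s * det B + t * det C
  det-column-linear {k} s t A B C A₀ A≈B A≈C = begin
    det A                      ≈⟨ det-expand A ⟩
    ∑ (term A)                 ≈⟨ ∑-cong terms ⟩
    (∑ λ j → s * term B j + t * term C j) ≈⟨ ∑-linear s t (term B) (term C) ⟩
    s * ∑ (term B) + t * ∑ (term C)       ≈⟨ +-cong (*-congˡ (det-expand B)) (*-congˡ (det-expand C)) ⟨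
    s * det B + t * det C      ∎
    where
    minor : ∀ {k} → Matrix (suc k) (suc k) → Fin (suc k) → Matrix k k
    minor A j a b = A (suc a) (punchIn j b)

    term : Matrix (suc k) (suc k) → Fin (suc k) → Carrier
    term A j = sgn (toℕ j) * (A zero j * det (minor A j))

    minors : ∀ {k} (A B C : Matrix (suc k) (suc k)) →
      (∀ i → A i zero ≈ s * B i zero + t * C i zero) →
      (∀ i j → A i (suc j) ≈ B i (suc j)) → (∀ i j → A i (suc j) ≈ C i (suc j)) →
      ∀ j → det (minor A (suc j)) ≈ s * det (minor B (suc j)) + t * det (minor C (suc j))
    minors {suc k} A B C A₀ A≈B A≈C j = det-column-linear s t (minor A (suc j)) (minor B (suc j)) (minor C (suc j))
      (A₀ ∘ suc) (λ a b → A≈B (suc a) (punchIn j b)) (λ a b → A≈C (suc a) (punchIn j b))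

    terms : ∀ j → term A j ≈ s * term B j + t * term C j
    terms zero = trans
      (*-congˡ (*-congʳ (A₀ zero)))
      (trans (solve 5 (λ s t b c d → 𝟙 :* ((s :* b :+ t :* c) :* d) := s :* (𝟙 :* (b :* d)) :+ t :* (𝟙 :* (c :* d)))
         refl s t (B zero zero) (C zero zero) (det (minor A zero)))
      (+-cong (*-congˡ (*-congˡ (*-congˡ (det-cong (minor A zero) (minor B zero) λ a b → A≈B (suc a) b))))
              (*-congˡ (*-congˡ (*-congˡ (det-cong (minor A zero) (minor C zero) λ a b → A≈C (suc a) b))))))
    terms (suc j) = trans
      (*-congˡ (*-congˡ (minors A B C A₀ A≈B A≈C j)))
      (trans (solve 6 (λ g a s t d e → g :* (a :* (s :* d :+ t :* e)) := s :* (g :* (a :* d)) :+ t :* (g :* (a :* e)))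
         refl (sgn (suc (toℕ j))) (A zero (suc j)) s t (det (minor B (suc j))) (det (minor C (suc j))))
      (+-cong (*-congˡ (*-congˡ (*-congʳ (A≈B zero j)))) (*-congˡ (*-congˡ (*-congʳ (A≈C zero j))))))

  -- For k rows T of a lower Hessenberg matrix of size k + 1, the vector y of
  -- cofactors of the missing last row.
  lower-Hessenberg-cofactors : ∀ {k} (T : Matrix k (suc k)) →
    (∀ a b → a Fin.< b → T a (suc b) ≈ 0#) → (∀ a → ¬ T a (suc a) ≈ 0#) →
    Σ (Fin (suc k) → Carrier) λ y → ¬ y zero ≈ 0# ×
      (∀ a → (∑ λ b → T a b * y b) ≈ 0#) ×
      (∀ N → (∀ a b → N (inject₁ a) b ≈ T a b) → det N ≈ ∑ λ b → N (fromℕ k) b * y b)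
  lower-Hessenberg-cofactors {zero} T _ _ = (λ _ → 1#) , (λ e → 0≉1 (sym e)) , (λ ()) ,
    λ N _ → trans (det-expand N) (∑-cong λ { zero →
      solve 1 (λ x → 𝟙 :* (x :* 𝟙) := x :* 𝟙) refl (N zero zero) })
  lower-Hessenberg-cofactors {suc k} T T≈0 T≉0 = y , *-≉0 (-‿≉0 m≉0) (proj₁ (proj₂ rec)) , Ty≈0 , cofactors
    where
    t = T zero zero
    m = T zero (suc zero)
    m≉0 = T≉0 zero

    -- The column operation clearing the first row, followed by the removal of
    -- that row.
    reduce : ∀ {l} → (Fin l → Fin (suc (suc k)) → Carrier) → Fin l → Fin (suc k) → Carrier
    reduce N a = (t * N a (suc zero) + - m * N a zero) ∷ λ b → N a (suc (suc b))

    rec = lower-Hessenberg-cofactors (reduce (T ∘ suc))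
      (λ a b a<b → T≈0 (suc a) (suc b) (s≤s a<b)) (λ a → T≉0 (suc a))
    y′ = proj₁ rec
    -- The transposed column operation applied to `y′`, so that `N` times `y` equals `reduce N`
    -- times `y′`.
    y = (- m * y′ zero) ∷ ((t * y′ zero) ∷ (y′ ∘ suc))

    reduced-product : ∀ {l} (N : Fin l → Fin (suc (suc k)) → Carrier) a →
      (∑ λ b → N a b * y b) ≈ ∑ λ b → reduce N a b * y′ b
    reduced-product N a = begin
      (∑ λ b → N a b * y b)  ≈⟨ trans (∑-suc _) (+-congˡ (∑-suc _)) ⟩
      N a zero * (- m * y′ zero) + (N a (suc zero) * (t * y′ zero) + S)
        ≈⟨ solve 6 (λ p q t m z s → p :* (:- m :* z) :+ (q :* (t :* z) :+ s) := (t :* q :+ :- m :* p) :* z :+ s)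
             refl (N a zero) (N a (suc zero)) t m (y′ zero) S ⟩
      (t * N a (suc zero) + - m * N a zero) * y′ zero + S ≈⟨ ∑-suc _ ⟨
      (∑ λ b → reduce N a b * y′ b) ∎
      where S = ∑ λ b → N a (suc (suc b)) * y′ (suc b)

    Ty≈0 : ∀ a → (∑ λ b → T a b * y b) ≈ 0#
    Ty≈0 (suc a) = trans (reduced-product (T ∘ suc) a) (proj₁ (proj₂ (proj₂ rec)) a)
    Ty≈0 zero = trans (reduced-product T zero) (trans (∑-suc _) (trans
      (+-cong (*-congʳ (solve 2 (λ t m → t :* m :+ :- m :* t := 𝟘) refl t m))
        (∑-≈0 λ b → trans (*-congʳ (T≈0 zero (suc b) (s≤s z≤n))) (zeroˡ _)))
      (solve 1 (λ z → 𝟘 :* z :+ 𝟘 := 𝟘) refl (y′ zero))))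

    cofactors : ∀ N → (∀ a b → N (inject₁ a) b ≈ T a b) → det N ≈ ∑ λ b → N (fromℕ (suc k)) b * y b
    cofactors N N≈T = begin
      det N  ≈⟨ trans (det-expand N) (trans (∑-suc _) (+-congˡ (∑-suc _))) ⟩
      1# * (N zero zero * D₀) + (- 1# * (N zero (suc zero) * D₁) + ∑ _)
        ≈⟨ +-cong (*-congˡ (*-congʳ (N≈T zero zero))) (+-cong (*-congˡ (*-congʳ (N≈T zero (suc zero))))
             (∑-≈0 λ b → trans (*-congˡ (trans (*-congʳ (trans (N≈T zero (suc (suc b))) (T≈0 zero (suc b) (s≤s z≤n)))) (zeroˡ _))) (zeroʳ _))) ⟩
      1# * (t * D₀) + (- 1# * (m * D₁) + 0#)
        ≈⟨ solve 4 (λ t m d e → 𝟙 :* (t :* d) :+ (:- 𝟙 :* (m :* e) :+ 𝟘) := t :* d :+ :- m :* e) refl t m D₀ D₁ ⟩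
      t * D₀ + - m * D₁
        -- The two remaining minors differ only in their first column, and their combination is the
        -- determinant after the column operation.
        ≈⟨ det-column-linear t (- m) (reduce (N ∘ suc)) (λ a b → N (suc a) (suc b)) (λ a b → N (suc a) (punchIn (suc zero) b))
             (λ i → refl) (λ i j → refl) (λ i j → refl) ⟨
      det (reduce (N ∘ suc))
        ≈⟨ proj₂ (proj₂ (proj₂ rec)) (reduce (N ∘ suc)) (λ
             { a zero → +-cong (*-congˡ (N≈T (suc a) (suc zero))) (*-congˡ (N≈T (suc a) zero))
             ; a (suc b) → N≈T (suc a) (suc (suc b)) }) ⟩
      (∑ λ b → reduce (N ∘ suc) (fromℕ k) b * y′ b) ≈⟨ reduced-product (N ∘ suc) (fromℕ k) ⟨
      (∑ λ b → N (fromℕ (suc k)) b * y b) ∎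
      where
      D₀ = det λ a b → N (suc a) (suc b)
      D₁ = det λ a b → N (suc a) (punchIn (suc zero) b)

  -- Left kernels.

  Kernel : ∀ {m k} → Matrix m k → Set
  Kernel {m} B = Σ (Fin m → Carrier) λ v → (∃ λ p → ¬ v p ≈ 0#) × (∀ l → (∑ λ i → v i * B i l) ≈ 0#)

  ∑-insertAt : ∀ {n} (v : Fin n → Carrier) p x (f : Fin (suc n) → Carrier) →
    (∑ λ i → insertAt v p x i * f i) ≈ x * f p + ∑ λ i → v i * f (punchIn p i)
  ∑-insertAt v p x f = trans (∑-remove p _) (+-cong
    (*-congʳ (reflexive (insertAt-lookup v p x)))
    (∑-cong λ i → *-congʳ (reflexive (insertAt-punchIn v p x i))))

  -- Elimination without division: with a pivot `b` in the first column, every other row is scaled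
  -- by `b` before a multiple of the pivot row is subtracted. Without a pivot the column vanishes
  -- and is dropped.
  more-rows⇒kernel : ∀ {k m} (B : Matrix m k) → k ℕ.< m → Kernel B
  more-rows⇒kernel {zero}  {suc m} B _ = (λ _ → 1#) , (zero , λ e → 0≉1 (sym e)) , λ ()
  more-rows⇒kernel {suc k} {suc m} B (s≤s k<m) with Fin.any? (λ p → ¬? (≈0? (B p zero)))
  ... | no ¬p with more-rows⇒kernel (λ i l → B i (suc l)) (ℕ.m<n⇒m<1+n k<m)
  ...   | v , nz , vB≈0 = v , nz , λ
    { zero    → ∑-≈0 λ i → trans (*-congˡ (decidable-stable (≈0? _) λ e → ¬p (i , e))) (zeroʳ _)
    ; (suc l) → vB≈0 l }
  more-rows⇒kernel {suc k} {suc m} B (s≤s k<m) | yes (p , b≉0) =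
    insertAt (λ i → b * v i) p x , (punchIn p q , λ e → *-≉0 b≉0 vq≉0
      (trans (sym (reflexive (insertAt-punchIn (λ i → b * v i) p x q))) e)) , vB≈0
    where
    b = B p zero
    c = λ i → B (punchIn p i) zero
    rec = more-rows⇒kernel (λ i l → b * B (punchIn p i) (suc l) + - c i * B p (suc l)) k<m
    v = proj₁ rec
    q = proj₁ (proj₁ (proj₂ rec))
    vq≉0 = proj₂ (proj₁ (proj₂ rec))
    -- The coefficient of the pivot row that clears column 0, given that the other coefficients are
    -- scaled by `b`.
    x = - (∑ λ i → v i * c i)

    combined : ∀ l → (∑ λ i → insertAt (λ i → b * v i) p x i * B i l)
                   ≈ ∑ λ i → v i * (b * B (punchIn p i) l + - c i * B p l)
    combined l = begin
      (∑ λ i → insertAt (λ i → b * v i) p x i * B i l)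
        ≈⟨ ∑-insertAt (λ i → b * v i) p x (λ i → B i l) ⟩
      x * B p l + (∑ λ i → b * v i * B (punchIn p i) l)
        ≈⟨ solve 3 (λ u w z → :- u :* w :+ z := :- w :* u :+ 𝟙 :* z) refl _ (B p l) _ ⟩
      - B p l * (∑ λ i → v i * c i) + 1# * (∑ λ i → b * v i * B (punchIn p i) l)
        ≈⟨ ∑-linear (- B p l) 1# _ _ ⟨
      (∑ λ i → - B p l * (v i * c i) + 1# * (b * v i * B (punchIn p i) l))
        ≈⟨ (∑-cong λ i → solve 5 (λ w v c b z → :- w :* (v :* c) :+ 𝟙 :* (b :* v :* z) := v :* (b :* z :+ :- c :* w))
             refl (B p l) (v i) (c i) b (B (punchIn p i) l)) ⟩
      (∑ λ i → v i * (b * B (punchIn p i) l + - c i * B p l)) ∎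

    vB≈0 : ∀ l → (∑ λ i → insertAt (λ i → b * v i) p x i * B i l) ≈ 0#
    vB≈0 zero = trans (combined zero) (∑-≈0 λ i →
      solve 3 (λ v b c → v :* (b :* c :+ :- c :* b) := 𝟘) refl (v i) b (c i))
    vB≈0 (suc l) = trans (combined (suc l)) (proj₂ (proj₂ rec) l)

  -- Skew-symmetric matrices

  SkewSymmetric : ∀ {n} → Matrix n n → Set
  SkewSymmetric A = ∀ i j → A i j ≈ - A j i

  skew-diagonal : ∀ {n} {A : Matrix n n} → SkewSymmetric A → ∀ i → A i i ≈ 0#
  skew-diagonal skew i = x≈-x⇒x≈0 (skew i i)

  -- The Schur complement of the rows and columns 0 and p + 1, scaled by the
  -- pivot A₀ₚ₊₁.
  module Schur {m} (A : Matrix (suc (suc m)) (suc (suc m))) (skew : SkewSymmetric A) (p : Fin (suc m)) where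

    a : Carrier
    a = A zero (suc p)

    ρ : Fin m → Fin (suc (suc m))
    ρ i = suc (punchIn p i)

    eliminated : Fin (suc (suc m)) → Fin (suc (suc m)) → Carrier
    eliminated i j = a * A i j + (A i zero * A (suc p) j - A i (suc p) * A zero j)

    complement : Matrix m m
    complement i j = eliminated (ρ i) (ρ j)

    eliminated-skew : SkewSymmetric eliminated
    eliminated-skew i j = trans
      (+-cong (*-congˡ (skew i j))
        (+-cong (*-cong (skew i zero) (skew (suc p) j))
          (-‿cong (*-cong (skew i (suc p)) (skew zero j)))))
      (solve 6 (λ a x b c d e → a :* :- x :+ (:- b :* :- c :- :- d :* :- e) := :- (a :* x :+ (e :* d :- c :* b)))
        refl a (A j i) (A zero i) (A j (suc p)) (A (suc p) i) (A j zero))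

    eliminated-0 : ∀ i → eliminated i zero ≈ 0#
    eliminated-0 i = trans (+-congˡ (+-cong (*-congˡ (skew (suc p) zero)) (-‿cong (*-congˡ (skew-diagonal skew zero)))))
      (solve 3 (λ a x y → a :* x :+ (x :* :- a :- y :* 𝟘) := 𝟘) refl a (A i zero) (A i (suc p)))

    eliminated-p : ∀ i → eliminated i (suc p) ≈ 0#
    eliminated-p i = trans (+-congˡ (+-congʳ (*-congˡ (skew-diagonal skew (suc p)))))
      (solve 3 (λ a x y → a :* y :+ (x :* 𝟘 :- y :* a) := 𝟘) refl a (A i zero) (A i (suc p)))

    -- The entries at 0 and p + 1 are chosen so that multiplying `A` by `extend w` combines the rows
    -- of `eliminated` with coefficients `w`.
    extend : (Fin m → Carrier) → Fin (suc (suc m)) → Carrier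
    extend w = (- (∑ λ i → w i * A (ρ i) (suc p))) ∷ insertAt (λ i → a * w i) p (∑ λ i → w i * A (ρ i) zero)

    extend-product : ∀ w j → (∑ λ i → extend w i * A i j) ≈ ∑ λ i → w i * eliminated (ρ i) j
    extend-product w j = begin
      (∑ λ i → extend w i * A i j)
        ≈⟨ trans (∑-suc _) (+-congˡ (∑-insertAt (λ i → a * w i) p S₀ (λ i → A (suc i) j))) ⟩
      - Sₚ * A zero j + (S₀ * A (suc p) j + (∑ λ i → a * w i * A (ρ i) j))
        ≈⟨ solve 5 (λ u x b y z → :- u :* x :+ (b :* y :+ z) := 𝟙 :* z :+ 𝟙 :* (y :* b :+ :- x :* u)) refl
             Sₚ (A zero j) S₀ (A (suc p) j) _ ⟩
      1# * (∑ λ i → a * w i * A (ρ i) j) + 1# * (A (suc p) j * S₀ + - A zero j * Sₚ)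
        ≈⟨ +-congˡ (*-congˡ (∑-linear (A (suc p) j) (- A zero j) _ _)) ⟨
      1# * (∑ λ i → a * w i * A (ρ i) j) + 1# * (∑ λ i → A (suc p) j * (w i * A (ρ i) zero) + - A zero j * (w i * A (ρ i) (suc p)))
        ≈⟨ ∑-linear 1# 1# _ _ ⟨
      (∑ λ i → 1# * (a * w i * A (ρ i) j) + 1# * (A (suc p) j * (w i * A (ρ i) zero) + - A zero j * (w i * A (ρ i) (suc p))))
        ≈⟨ (∑-cong λ i → solve 7 (λ a w x y b z c →
              𝟙 :* (a :* w :* x) :+ 𝟙 :* (y :* (w :* b) :+ :- z :* (w :* c)) := w :* (a :* x :+ (b :* y :- c :* z)))
             refl a (w i) (A (ρ i) j) (A (suc p) j) (A (ρ i) zero) (A zero j) (A (ρ i) (suc p))) ⟩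
      (∑ λ i → w i * eliminated (ρ i) j) ∎
      where
      S₀ = ∑ λ i → w i * A (ρ i) zero
      Sₚ = ∑ λ i → w i * A (ρ i) (suc p)

    extend-kernel : ∀ w → (∀ j → (∑ λ i → w i * complement i j) ≈ 0#) → ∀ j → (∑ λ i → extend w i * A i j) ≈ 0#
    extend-kernel w w≈0 zero = trans (extend-product w zero)
      (∑-≈0 λ i → trans (*-congˡ (eliminated-0 (ρ i))) (zeroʳ _))
    extend-kernel w w≈0 (suc j) with p Fin.≟ j
    ... | yes ≡.refl = trans (extend-product w (suc p))
                         (∑-≈0 λ i → trans (*-congˡ (eliminated-p (ρ i))) (zeroʳ _))
    ... | no p≢j     = ≡.subst (λ j → (∑ λ i → extend w i * A i (suc j)) ≈ 0#) (Fin.punchIn-punchOut p≢j)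
                         (trans (extend-product w (ρ (punchOut p≢j))) (w≈0 (punchOut p≢j)))

    kernel : ¬ a ≈ 0# → Kernel complement → Kernel A
    kernel a≉0 (w , (s , ws≉0) , w≈0) = extend w ,
      (ρ s , λ e → *-≉0 a≉0 ws≉0 (trans (sym (reflexive (insertAt-punchIn (λ i → a * w i) p _ s))) e)) ,
      extend-kernel w w≈0

  -- A nonzero entry in row 0 gives a pivot block of size two, whose complement is skew of odd order
  -- again. If row 0 vanishes, the first unit vector is in the kernel.
  odd-skew⇒kernel : ∀ q (A : Matrix (suc (q ℕ.* 2)) (suc (q ℕ.* 2))) → SkewSymmetric A → Kernel A
  odd-skew⇒kernel zero A skew = (λ _ → 1#) , (zero , λ e → 0≉1 (sym e)) ,
    λ { zero → ∑-≈0 λ { zero → trans (*-congˡ (skew-diagonal skew zero)) (zeroʳ 1#) } }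
  odd-skew⇒kernel (suc q) A skew with Fin.any? (λ p → ¬? (≈0? (A zero p)))
  ... | no ¬p = (1# ∷ λ _ → 0#) , (zero , λ e → 0≉1 (sym e)) , λ j → trans (∑-suc _) (trans
          (+-cong (trans (*-congˡ (decidable-stable (≈0? (A zero j)) λ e → ¬p (j , e))) (zeroʳ 1#)) (∑-≈0 λ i → zeroˡ _))
          (+-identityˡ 0#))
  ... | yes (zero  , a≉0) = contradiction (skew-diagonal skew zero) a≉0
  ... | yes (suc p , a≉0) = Schur.kernel A skew p a≉0
          (odd-skew⇒kernel q (Schur.complement A skew p) λ i j → Schur.eliminated-skew A skew p _ _)

  -- At the index of the first nonzero entry of `v`, the product has just one nonzero term, the
  -- diagonal one.
  upper-triangular-injective : ∀ {k} (U : Matrix k k) → (∀ b a → a Fin.< b → U b a ≈ 0#) →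
    (∀ a → ¬ U a a ≈ 0#) → ∀ (v : Fin k → Carrier) p → ¬ v p ≈ 0# →
    ∃ λ a → ¬ (∑ λ b → v b * U b a) ≈ 0#
  upper-triangular-injective {suc k} U U≈0 U≉0 v p vp≉0 with ≈0? (v zero)
  ... | no v₀≉0 = zero , λ e → *-≉0 v₀≉0 (U≉0 zero) (trans (sym (trans (∑-suc _) (trans
          (+-congˡ (∑-≈0 λ b → trans (*-congˡ (U≈0 (suc b) zero (s≤s z≤n))) (zeroʳ _))) (+-identityʳ _)))) e)
  ... | yes v₀≈0 with p
  ...   | zero  = contradiction v₀≈0 vp≉0
  ...   | suc p with upper-triangular-injective (λ b a → U (suc b) (suc a))
                       (λ b a a<b → U≈0 (suc b) (suc a) (s≤s a<b)) (U≉0 ∘ suc) (v ∘ suc) p vp≉0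
  ...     | a , ≉0 = suc a , λ e → ≉0 (trans (sym (trans (∑-suc _) (trans
              (+-congʳ (trans (*-congʳ v₀≈0) (zeroˡ _))) (+-identityˡ _)))) e)

  -- Increasing index sequences.

  snoc : ∀ {k} {X : Set} → (Fin k → X) → X → Fin (suc k) → X
  snoc {zero}  f x _       = x
  snoc {suc k} f x zero    = f zero
  snoc {suc k} f x (suc i) = snoc (f ∘ suc) x i

  snoc-inject₁ : ∀ {k} {X : Set} (f : Fin k → X) x i → snoc f x (inject₁ i) ≡ f i
  snoc-inject₁ f x zero    = ≡.refl
  snoc-inject₁ f x (suc i) = snoc-inject₁ (f ∘ suc) x i

  snoc-fromℕ : ∀ {k} {X : Set} (f : Fin k → X) x → snoc f x (fromℕ k) ≡ x
  snoc-fromℕ {zero}  f x = ≡.refl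
  snoc-fromℕ {suc k} f x = snoc-fromℕ (f ∘ suc) x

  snoc-increasing : ∀ {k n} (f : Fin k → Fin n) i → Increasing f → (∀ a → f a Fin.< i) → Increasing (snoc f i)
  snoc-increasing {zero}  f i inc f<i zero zero ()
  snoc-increasing {suc k} f i inc f<i zero (suc b) _ = below (f ∘ suc) (λ c → inc zero (suc c) (s≤s z≤n)) b
    where
    below : ∀ {l} (g : Fin l → Fin _) → (∀ c → f zero Fin.< g c) → ∀ b → f zero Fin.< snoc g i b
    below {zero}  g _ _       = f<i zero
    below {suc l} g h zero    = h zero
    below {suc l} g h (suc b) = below (g ∘ suc) (h ∘ suc) b
  snoc-increasing {suc k} f i inc f<i (suc a) (suc b) (s≤s a<b) =
    snoc-increasing (f ∘ suc) i (λ a b a<b → inc (suc a) (suc b) (s≤s a<b)) (f<i ∘ suc) a b a<b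

  ∷-increasing : ∀ {k n} j (g : Fin k → Fin n) → Increasing g → (∀ b → j Fin.< g b) → Increasing (j ∷ g)
  ∷-increasing j g inc j<g zero    (suc b) _         = j<g b
  ∷-increasing j g inc j<g (suc a) (suc b) (s≤s a<b) = inc a b a<b

  -- Lower bounds on the rank of a band matrix.

  module Band (r k : ℕ) (A : Matrix (r ℕ.+ k) (r ℕ.+ k)) (skew : SkewSymmetric A)
    (outside : ∀ i j → toℕ i ℕ.+ r ℕ.< toℕ j → A i j ≈ 0#)
    (edge : ∀ i j → toℕ j ≡ toℕ i ℕ.+ r → ¬ A i j ≈ 0#) where

    -- The first k and the last k indices: the diagonal of A[f,g] is the r-th superdiagonal of `A`,
    -- and the entries above it lie outside the band.
    f g : Fin k → Fin (r ℕ.+ k)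
    f a = inject≤ a (ℕ.m≤n+m k r)
    g b = r ↑ʳ b

    toℕ-f : ∀ a → toℕ (f a) ≡ toℕ a
    toℕ-f a = Fin.toℕ-inject≤ a (ℕ.m≤n+m k r)

    toℕ-g : ∀ b → toℕ (g b) ≡ toℕ b ℕ.+ r
    toℕ-g b = ≡.trans (Fin.toℕ-↑ʳ r b) (ℕ.+-comm r (toℕ b))

    f-increasing : Increasing f
    f-increasing a b a<b = ≡.subst₂ ℕ._<_ (≡.sym (toℕ-f a)) (≡.sym (toℕ-f b)) a<b

    g-increasing : Increasing g
    g-increasing a b a<b = ≡.subst₂ ℕ._<_ (≡.sym (toℕ-g a)) (≡.sym (toℕ-g b)) (ℕ.+-monoˡ-< r a<b)

    in-f : ∀ i → toℕ i ℕ.< k → ∃ λ a → i ≡ f a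
    in-f i i<k = Fin.fromℕ< i<k , Fin.toℕ-injective
      (≡.sym (≡.trans (toℕ-f (Fin.fromℕ< i<k)) (Fin.toℕ-fromℕ< i<k)))

    in-g : ∀ j → r ℕ.≤ toℕ j → ∃ λ b → j ≡ g b
    in-g j r≤j = Fin.reduce≥ j r≤j , ≡.sym (Fin.splitAt⁻¹-↑ʳ (Fin.splitAt-≥ r j r≤j))

    outside-fg : ∀ a b → a Fin.< b → A (f a) (g b) ≈ 0#
    outside-fg a b a<b = outside (f a) (g b)
      (≡.subst₂ ℕ._<_ (≡.cong (ℕ._+ r) (≡.sym (toℕ-f a))) (≡.sym (toℕ-g b)) (ℕ.+-monoˡ-< r a<b))

    edge-fg : ∀ a → ¬ A (f a) (g a) ≈ 0#
    edge-fg a = edge (f a) (g a) (≡.trans (toℕ-g a) (≡.cong (ℕ._+ r) (≡.sym (toℕ-f a))))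

    minor-k : HasNonzeroMinor A k
    minor-k = f , g , f-increasing , g-increasing ,
      det-lower-triangular≉0 (λ a b → A (f a) (g b)) outside-fg edge-fg

    -- If v ≠ 0 is in the kernel of A[g,g] then vA[g,·] is nonzero at some column
    -- j = f a, necessarily to the left of g. Let y be the cofactors of
    -- A[f,(j,g)], and e = A[·,(j,g)] y. Then v e[g] = (vA[g,·])ⱼ y₀ ≠ 0, so that
    -- some e i with i in g is nonzero, while e vanishes on f; e i is the minor
    -- with rows (f,i) and columns (j,g).
    minor-suc-k : Kernel (λ a b → A (g a) (g b)) → HasNonzeroMinor A (suc k)
    minor-suc-k (v , (p , vp≉0) , vA≈0) = rows , cols , rows-increasing , cols-increasing ,
      λ eq → ei≉0 (trans (sym minor≈ei) eq)
      where
      d = λ j → ∑ λ b → v b * A (g b) j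

      -- By skew symmetry A[g,f] is the negative transpose of A[f,g], hence upper triangular with
      -- nonzero diagonal.
      triangular = upper-triangular-injective (λ b a → A (g b) (f a))
        (λ b a a<b → trans (skew (g b) (f a)) (trans (-‿cong (outside-fg a b a<b)) -0#≈0#))
        (λ a e → -‿≉0 (edge-fg a) (trans (sym (skew (g a) (f a))) e)) v p vp≉0
      j = f (proj₁ triangular)
      dj≉0 = proj₂ triangular

      j<r : toℕ j ℕ.< r
      j<r = ℕ.≰⇒> λ r≤j → let b , j≡gb = in-g j r≤j in
        dj≉0 (≡.subst (λ j → d j ≈ 0#) (≡.sym j≡gb) (vA≈0 b))

      cols = j ∷ g
      cols-increasing : Increasing cols
      cols-increasing = ∷-increasing j g g-increasing λ b → ℕ.<-≤-trans j<r
        (≡.subst (r ℕ.≤_) (≡.sym (toℕ-g b)) (ℕ.m≤n+m r (toℕ b)))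

      -- Putting column `j` in front of the triangular A[f,g] moves its diagonal to the
      -- superdiagonal.
      hessenberg = lower-Hessenberg-cofactors (λ a b → A (f a) (cols b)) outside-fg edge-fg
      y = proj₁ hessenberg
      e = λ i → ∑ λ b → A i (cols b) * y b

      v·e≈dj*y₀ : (∑ λ b → v b * e (g b)) ≈ d j * y zero
      v·e≈dj*y₀ = begin
        (∑ λ b → v b * e (g b))
          ≈⟨ ∑-cong (λ b → *-∑ (v b) _) ⟩
        (∑ λ b → ∑ λ c → v b * (A (g b) (cols c) * y c))
          ≈⟨ ∑-swap _ ⟩
        (∑ λ c → ∑ λ b → v b * (A (g b) (cols c) * y c))
          ≈⟨ ∑-cong (λ c → trans (∑-cong λ b → sym (*-assoc (v b) _ (y c))) (sym (∑-* _ (y c)))) ⟩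
        (∑ λ c → d (cols c) * y c)
          ≈⟨ ∑-suc _ ⟩
        d j * y zero + (∑ λ c → d (g c) * y (suc c))
          ≈⟨ +-congˡ (∑-≈0 λ c → trans (*-congʳ (vA≈0 c)) (zeroˡ _)) ⟩
        d j * y zero + 0#
          ≈⟨ +-identityʳ _ ⟩
        d j * y zero ∎

      some = ∑≉0⇒∃ (λ b → v b * e (g b)) λ eq →
        *-≉0 dj≉0 (proj₁ (proj₂ hessenberg)) (trans (sym v·e≈dj*y₀) eq)
      i = g (proj₁ some)
      ei≉0 : ¬ e i ≈ 0#
      ei≉0 eq = proj₂ some (trans (*-congˡ eq) (zeroʳ _))

      k≤i : k ℕ.≤ toℕ i
      k≤i = ℕ.≮⇒≥ λ i<k → let a , i≡fa = in-f i i<k in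
        ei≉0 (≡.subst (λ i → e i ≈ 0#) (≡.sym i≡fa) (proj₁ (proj₂ (proj₂ hessenberg)) a))

      rows = snoc f i
      rows-increasing : Increasing rows
      rows-increasing = snoc-increasing f i f-increasing λ a →
        ℕ.<-≤-trans (≡.subst (ℕ._< k) (≡.sym (toℕ-f a)) (Fin.toℕ<n a)) k≤i

      minor≈ei : det (λ a b → A (rows a) (cols b)) ≈ e i
      minor≈ei = trans
        (proj₂ (proj₂ (proj₂ hessenberg)) (λ a b → A (rows a) (cols b))
          λ a b → reflexive (≡.cong (λ h → A h (cols b)) (snoc-inject₁ f i a)))
        (reflexive (≡.cong e (snoc-fromℕ f i)))

  -- Powers of paths

  -- The position of i relative to the window [o , o + r + 1].
  data Place (o r i : ℕ) : Set where
    before : i ℕ.< o → Place o r i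
    first  : i ≡ o → Place o r i
    inner  : o ℕ.< i → i ℕ.< o ℕ.+ suc r → Place o r i
    last   : i ≡ o ℕ.+ suc r → Place o r i
    after  : o ℕ.+ suc r ℕ.< i → Place o r i

  place : ∀ o r i → Place o r i
  place o r i with ℕ.<-cmp i o
  ... | tri< i<o _ _ = before i<o
  ... | tri≈ _ i≡o _ = first i≡o
  ... | tri> _ _ o<i with ℕ.<-cmp i (o ℕ.+ suc r)
  ...   | tri< i<e _ _ = inner o<i i<e
  ...   | tri≈ _ i≡e _ = last i≡e
  ...   | tri> _ _ e<i = after e<i

  -- The vectors (α , β) are (0 , −1), (1 , o + 1), …, (1 , o + r), (0 , 1) along
  -- the window: they turn counterclockwise through exactly half a circle.
  α β : ∀ {o r i} → Place o r i → Carrier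
  α (inner _ _) = 1#
  α _           = 0#
  β (first _)           = - 1#
  β {i = i} (inner _ _) = i · 1#
  β (last _)            = 1#
  β _                   = 0#

  -- The determinant of the vectors at `i` and `j`, for i < j, as a natural number: this makes its
  -- nonnegativity evident. The antiparallel extreme vectors get 0.
  weight : ∀ {o r i j} → Place o r i → Place o r j → ℕ
  weight (first _) (inner _ _) = 1
  weight {i = i} {j} (inner _ _) (inner _ _) = j ℕ.∸ i
  weight (inner _ _) (last _) = 1
  weight _ _ = 0

  wedge-0ˡ : ∀ {o r i} (Q : Place o r i) → 0# * β Q - α Q * 0# ≈ 0#
  wedge-0ˡ Q = solve 2 (λ a b → 𝟘 :* b :- a :* 𝟘 := 𝟘) refl (α Q) (β Q)

  wedge-0ʳ : ∀ {o r i} (P : Place o r i) → α P * 0# - 0# * β P ≈ 0#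
  wedge-0ʳ P = solve 2 (λ a b → a :* 𝟘 :- 𝟘 :* b := 𝟘) refl (α P) (β P)

  -- The order of `i` and `j` makes the truncated difference exact. It also excludes an inner place
  -- followed by the first, and the last followed by an inner one, where the determinant is -1.
  wedge≈weight : ∀ {o r i j} (P : Place o r i) (Q : Place o r j) → i ℕ.< j →
    α P * β Q - α Q * β P ≈ weight P Q · 1#
  wedge≈weight (before _) Q i<j = wedge-0ˡ Q
  wedge≈weight (after _)  Q i<j = wedge-0ˡ Q
  wedge≈weight P@(first _)   (before _) i<j = wedge-0ʳ P
  wedge≈weight P@(inner _ _) (before _) i<j = wedge-0ʳ P
  wedge≈weight P@(last _)    (before _) i<j = wedge-0ʳ P
  wedge≈weight P@(first _)   (after _)  i<j = wedge-0ʳ P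
  wedge≈weight P@(inner _ _) (after _)  i<j = wedge-0ʳ P
  wedge≈weight P@(last _)    (after _)  i<j = wedge-0ʳ P
  wedge≈weight (first _) (first _) i<j = solve 0 (𝟘 :* :- 𝟙 :- 𝟘 :* :- 𝟙 := 𝟘) refl
  wedge≈weight (first _) (last _)  i<j = solve 0 (𝟘 :* 𝟙 :- 𝟘 :* :- 𝟙 := 𝟘) refl
  wedge≈weight (last _)  (first _) i<j = solve 0 (𝟘 :* :- 𝟙 :- 𝟘 :* 𝟙 := 𝟘) refl
  wedge≈weight (last _)  (last _)  i<j = solve 0 (𝟘 :* 𝟙 :- 𝟘 :* 𝟙 := 𝟘) refl
  wedge≈weight {j = j} (first _) (inner _ _) i<j =
    solve 1 (λ x → 𝟘 :* x :- 𝟙 :* :- 𝟙 := 𝟙 :+ 𝟘) refl (j · 1#)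
  wedge≈weight {i = i} (inner _ _) (last _) i<j =
    solve 1 (λ x → 𝟙 :* 𝟙 :- 𝟘 :* x := 𝟙 :+ 𝟘) refl (i · 1#)
  wedge≈weight {i = i} {j} (inner _ _) (inner _ _) i<j = begin
    1# * (j · 1#) - 1# * (i · 1#)
      ≈⟨ +-congʳ (*-congˡ (trans (reflexive (≡.cong (_· 1#) (≡.sym (ℕ.m+[n∸m]≡n (ℕ.<⇒≤ i<j)))))
           (×-homo-+ 1# i (j ℕ.∸ i)))) ⟩
    1# * (i · 1# + (j ℕ.∸ i) · 1#) - 1# * (i · 1#)
      ≈⟨ solve 2 (λ x y → 𝟙 :* (x :+ y) :- 𝟙 :* x := y) refl (i · 1#) _ ⟩
    (j ℕ.∸ i) · 1# ∎
  wedge≈weight (inner o<i _) (first ≡.refl) i<j = contradiction i<j (ℕ.<-asym o<i)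
  wedge≈weight (last ≡.refl) (inner _ j<e)  i<j = contradiction i<j (ℕ.<-asym j<e)

  -- Within a window of r + 2 indices only the first and the last are more than `r` apart.
  weight-far : ∀ {o r i j} (P : Place o r i) (Q : Place o r j) → i ℕ.+ r ℕ.< j → weight P Q ≡ 0
  weight-far {o} {r} {j = j} (first ≡.refl) (inner _ j<e) far = contradiction far
    (ℕ.≤⇒≯ (ℕ.s≤s⁻¹ (≡.subst (j ℕ.<_) (ℕ.+-suc o r) j<e)))
  weight-far {o} {r} {j = j} (inner o<i _) (inner _ j<e) far = contradiction far
    (ℕ.≤⇒≯ (ℕ.≤-trans (ℕ.<⇒≤ (≡.subst (j ℕ.<_) (ℕ.+-suc o r) j<e)) (ℕ.+-monoˡ-≤ r o<i)))
  weight-far {o} {r} {i} (inner o<i _) (last ≡.refl) far = contradiction far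
    (ℕ.≤⇒≯ (≡.subst (ℕ._≤ i ℕ.+ r) (≡.sym (ℕ.+-suc o r)) (ℕ.+-monoˡ-≤ r o<i)))
  weight-far (before _) _ far = ≡.refl
  weight-far (last _) _ far = ≡.refl
  weight-far (after _) _ far = ≡.refl
  weight-far (first _) (before _) far = ≡.refl
  weight-far (first _) (first _) far = ≡.refl
  weight-far (first _) (last _) far = ≡.refl
  weight-far (first _) (after _) far = ≡.refl
  weight-far (inner _ _) (before _) far = ≡.refl
  weight-far (inner _ _) (first _) far = ≡.refl
  weight-far (inner _ _) (after _) far = ≡.refl

  -- Two places of the window at distance between 1 and `r` are not both extreme, so the angle
  -- between their vectors lies strictly between zero and half a turn.
  weight-near : ∀ {o r i j} (P : Place o r i) (Q : Place o r j) → i ℕ.< j → j ℕ.≤ i ℕ.+ r →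
    o ℕ.≤ i → j ℕ.≤ o ℕ.+ suc r → ¬ weight P Q ≡ 0
  weight-near (before i<o) _ _ _ o≤i _ _ = ℕ.≤⇒≯ o≤i i<o
  weight-near (last ≡.refl) _ i<j _ _ j≤e _ = ℕ.≤⇒≯ j≤e i<j
  weight-near (after e<i) _ i<j _ _ j≤e _ = ℕ.≤⇒≯ j≤e (ℕ.<-trans e<i i<j)
  weight-near (first _) (after e<j) _ _ _ j≤e _ = ℕ.≤⇒≯ j≤e e<j
  weight-near (inner _ _) (after e<j) _ _ _ j≤e _ = ℕ.≤⇒≯ j≤e e<j
  weight-near (first _) (before j<o) i<j _ o≤i _ _ = ℕ.≤⇒≯ o≤i (ℕ.<-trans i<j j<o)
  weight-near (inner _ _) (before j<o) i<j _ o≤i _ _ = ℕ.≤⇒≯ o≤i (ℕ.<-trans i<j j<o)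
  weight-near (first _) (first ≡.refl) i<j _ o≤i _ _ = ℕ.≤⇒≯ o≤i i<j
  weight-near (inner _ _) (first ≡.refl) i<j _ o≤i _ _ = ℕ.≤⇒≯ o≤i i<j
  weight-near {o} {r} (first ≡.refl) (last ≡.refl) _ near _ _ _ =
    ℕ.≤⇒≯ near (ℕ.+-monoʳ-< o (ℕ.n<1+n r))
  weight-near (inner _ _) (inner _ _) i<j _ _ _ = ℕ.m>n⇒m∸n≢0 i<j
  weight-near (first _) (inner _ _) _ _ _ _ ()
  weight-near (inner _ _) (last _) _ _ _ _ ()

  -- The window starts at the largest even number up to `i`, or is the last one if none starts
  -- there. Having r + 2 indices, it reaches i + r even when it starts at i - 1; in the last window
  -- the bound on `j` suffices.
  window : ∀ q {r i j} → i ℕ.< j → j ℕ.≤ i ℕ.+ r → j ℕ.< suc q ℕ.* 2 ℕ.+ r →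
    Σ (Fin (suc q)) λ p → toℕ p ℕ.* 2 ℕ.≤ i × j ℕ.≤ toℕ p ℕ.* 2 ℕ.+ suc r
  window zero    {r} _ _ (s≤s j≤1+r) = zero , z≤n , j≤1+r
  window (suc q) {r} {zero}  _ near _ = zero , z≤n , ℕ.m≤n⇒m≤1+n near
  window (suc q) {r} {suc zero} _ near _ = zero , z≤n , near
  window (suc q) {r} {suc (suc i)} (s≤s (s≤s i<j)) (s≤s (s≤s near)) (s≤s (s≤s j<))
    with window q i<j near j<
  ... | p , p≤i , j≤ = suc p , s≤s (s≤s p≤i) , s≤s (s≤s j≤)

  -- The matrix of small rank.

  module Construction (q r n : ℕ) where

    a b : Fin q → Fin n → Carrier
    a p i = α (place (toℕ p ℕ.* 2) r (toℕ i))
    b p i = β (place (toℕ p ℕ.* 2) r (toℕ i))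

    A : Matrix n n
    A i j = ∑ λ p → a p i * b p j - a p j * b p i

    A-skew : SkewSymmetric A
    A-skew i j = begin
      (∑ λ p → a p i * b p j - a p j * b p i)
        ≈⟨ (∑-cong λ p → solve 4 (λ x y z w → x :* w :- z :* y := :- 𝟙 :* (z :* y :- x :* w)) refl
             (a p i) (b p i) (a p j) (b p j)) ⟩
      (∑ λ p → - 1# * (a p j * b p i - a p i * b p j))  ≈⟨ *-∑ (- 1#) _ ⟨
      - 1# * A j i                                        ≈⟨ -1*x≈-x _ ⟩
      - A j i                                             ∎

    A≈∑weight : ∀ i j → i Fin.< j → A i j ≈ ∑ λ p →
      weight (place (toℕ p ℕ.* 2) r (toℕ i)) (place (toℕ p ℕ.* 2) r (toℕ j)) · 1#
    A≈∑weight i j i<j = ∑-cong λ p →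
      wedge≈weight (place (toℕ p ℕ.* 2) r (toℕ i)) (place (toℕ p ℕ.* 2) r (toℕ j)) i<j

    A-far : ∀ i j → i Fin.< j → toℕ i ℕ.+ r ℕ.< toℕ j → A i j ≈ 0#
    A-far i j i<j far = trans (A≈∑weight i j i<j) (∑-≈0 λ p → reflexive (≡.cong (_· 1#)
      (weight-far (place (toℕ p ℕ.* 2) r (toℕ i)) (place (toℕ p ℕ.* 2) r (toℕ j)) far)))

    -- More than 2q selected rows admit a nontrivial combination that annihilates all 2q coordinate
    -- vectors `a p` and `b p`, and with them every column of `A`.
    no-large-minor : ∀ m → q ℕ.* 2 ℕ.< m → ¬ HasNonzeroMinor A m
    no-large-minor m 2q<m (f , g , _ , _ , det≉0) = det≉0 (left-kernel⇒det≈0 (λ i j → A (f i) (g j)) v s vs≉0 vA≈0)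
      where
      coordinate : Fin q × Fin 2 → Fin n → Carrier
      coordinate (p , zero)     = a p
      coordinate (p , suc zero) = b p

      kernel = more-rows⇒kernel (λ i l → coordinate (remQuot 2 l) (f i)) 2q<m
      v = proj₁ kernel
      s = proj₁ (proj₁ (proj₂ kernel))
      vs≉0 = proj₂ (proj₁ (proj₂ kernel))

      v·coordinate≈0 : ∀ p c → (∑ λ i → v i * coordinate (p , c) (f i)) ≈ 0#
      v·coordinate≈0 p c = ≡.subst (λ x → (∑ λ i → v i * coordinate x (f i)) ≈ 0#)
        (Fin.remQuot-combine p c) (proj₂ (proj₂ kernel) (combine p c))

      vA≈0 : ∀ j → (∑ λ i → v i * A (f i) (g j)) ≈ 0#
      vA≈0 j = begin
        (∑ λ i → v i * A (f i) (g j))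
          ≈⟨ ∑-cong (λ i → *-∑ (v i) _) ⟩
        (∑ λ i → ∑ λ p → v i * (a p (f i) * b p (g j) - a p (g j) * b p (f i)))
          ≈⟨ ∑-swap _ ⟩
        (∑ λ p → ∑ λ i → v i * (a p (f i) * b p (g j) - a p (g j) * b p (f i)))
          ≈⟨ (∑-≈0 λ p → begin
            (∑ λ i → v i * (a p (f i) * b p (g j) - a p (g j) * b p (f i)))
              ≈⟨ (∑-cong λ i → solve 5 (λ v x y z w → v :* (x :* w :- z :* y) := w :* (v :* x) :+ :- z :* (v :* y)) refl
                   (v i) (a p (f i)) (b p (f i)) (a p (g j)) (b p (g j))) ⟩
            (∑ λ i → b p (g j) * (v i * a p (f i)) + - a p (g j) * (v i * b p (f i)))
              ≈⟨ ∑-linear (b p (g j)) (- a p (g j)) _ _ ⟩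
            b p (g j) * (∑ λ i → v i * a p (f i)) + - a p (g j) * (∑ λ i → v i * b p (f i))
              ≈⟨ +-cong (*-congˡ (v·coordinate≈0 p zero)) (*-congˡ (v·coordinate≈0 p (suc zero))) ⟩
            b p (g j) * 0# + - a p (g j) * 0#
              ≈⟨ solve 2 (λ x y → x :* 𝟘 :+ y :* 𝟘 := 𝟘) refl (b p (g j)) (- a p (g j)) ⟩
            0# ∎) ⟩
        0# ∎

  ∣-∣≤⇒≤+ : ∀ {i j r} → ∣ i - j ∣ ℕ.≤ r → j ℕ.≤ i ℕ.+ r
  ∣-∣≤⇒≤+ {i} {j} p = ℕ.≤-trans (ℕ.m≤n+∣n-m∣ j i) (ℕ.+-monoʳ-≤ i p)

  ≤+⇒∣-∣≤ : ∀ {i j r} → i ℕ.≤ j → j ℕ.≤ i ℕ.+ r → ∣ i - j ∣ ℕ.≤ r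
  ≤+⇒∣-∣≤ {i} {j} {r} i≤j j≤ = ≡.subst (ℕ._≤ r) (≡.sym (ℕ.m≤n⇒∣m-n∣≡n∸m i≤j)) (ℕ.m≤n+o⇒m∸n≤o j i j≤)

  -- The bound on `n` says that the windows reach the last index. Each edge then lies in some
  -- window, which contributes a positive term to a sum of nonnegative ones.
  Construction-InSkew : ∀ q r n → n ℕ.≤ suc q ℕ.* 2 ℕ.+ r →
    InSkew (pathPower n r) (Construction.A (suc q) r n)
  Construction-InSkew q r n n≤ = A-skew , λ i j i≢j → pattern⇒ i j i≢j , pattern⇐ i j
    where
    open Construction (suc q) r n

    A-near : ∀ i j → i Fin.< j → toℕ j ℕ.≤ toℕ i ℕ.+ r → ¬ A i j ≈ 0#
    A-near i j i<j near e with window q i<j near (ℕ.<-≤-trans (Fin.toℕ<n j) n≤)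
    ... | p , p≤i , j≤ = ∑-nonneg-≉0 _ (λ p → ·1-nonneg (w p)) p wp≉0 (trans (sym (A≈∑weight i j i<j)) e)
      where
      w = λ (p : Fin (suc q)) → weight (place (toℕ p ℕ.* 2) r (toℕ i)) (place (toℕ p ℕ.* 2) r (toℕ j))
      wp≉0 : ¬ w p · 1# ≈ 0#
      wp≉0 with w p in eq
      ... | zero  = contradiction eq (weight-near (place (toℕ p ℕ.* 2) r (toℕ i)) (place (toℕ p ℕ.* 2) r (toℕ j)) i<j near p≤i j≤)
      ... | suc m = suc·1≉0 m

    pattern< : ∀ i j → i Fin.< j → ¬ A i j ≈ 0# → ∣ toℕ i - toℕ j ∣ ℕ.≤ r
    pattern< i j i<j A≉0 = ≤+⇒∣-∣≤ (ℕ.<⇒≤ i<j) (ℕ.≮⇒≥ λ far → A≉0 (A-far i j i<j far))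

    flip-≉0 : ∀ i j → ¬ A i j ≈ 0# → ¬ A j i ≈ 0#
    flip-≉0 i j ≉0 e = ≉0 (trans (A-skew i j) (trans (-‿cong e) -0#≈0#))

    pattern⇒ : ∀ i j → i ≢ j → ¬ A i j ≈ 0# → pathPower n r i j
    pattern⇒ i j i≢j A≉0 with Fin.<-cmp i j
    ... | tri< i<j _ _ = i≢j , pattern< i j i<j A≉0
    ... | tri≈ _ i≡j _ = contradiction i≡j i≢j
    ... | tri> _ _ j<i = i≢j , ≡.subst (ℕ._≤ r) (ℕ.∣-∣-comm (toℕ j) (toℕ i)) (pattern< j i j<i (flip-≉0 i j A≉0))

    pattern⇐ : ∀ i j → pathPower n r i j → ¬ A i j ≈ 0#
    pattern⇐ i j (i≢j , d≤r) with Fin.<-cmp i j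
    ... | tri< i<j _ _ = A-near i j i<j (∣-∣≤⇒≤+ d≤r)
    ... | tri≈ _ i≡j _ = contradiction i≡j i≢j
    ... | tri> _ _ j<i = flip-≉0 j i (A-near j i j<i (∣-∣≤⇒≤+ (≡.subst (ℕ._≤ r) (ℕ.∣-∣-comm (toℕ i) (toℕ j)) d≤r)))

  -- The pattern only refutes that the entry is nonzero; decidability turns this into vanishing.
  InSkew⇒outside : ∀ {n r A} → InSkew (pathPower n r) A → ∀ i j → toℕ i ℕ.+ r ℕ.< toℕ j → A i j ≈ 0#
  InSkew⇒outside {n} {r} {A} A∈S i j far = decidable-stable (≈0? (A i j)) λ A≉0 →
    ℕ.<⇒≱ far (∣-∣≤⇒≤+ (proj₂ (proj₁ (proj₂ A∈S i j i≢j) A≉0)))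
    where
    i≢j : i ≢ j
    i≢j ≡.refl = ℕ.m+n≮m (toℕ i) r far

  InSkew⇒edge : ∀ {n r A} → 1 ℕ.≤ r → InSkew (pathPower n r) A →
    ∀ i j → toℕ j ≡ toℕ i ℕ.+ r → ¬ A i j ≈ 0#
  InSkew⇒edge {n} {r} 1≤r A∈S i j j≡i+r = proj₂ (proj₂ A∈S i j i≢j)
    (i≢j , ℕ.≤-reflexive (≡.trans (≡.cong (∣ toℕ i -_∣) j≡i+r) (ℕ.∣m-m+n∣≡n (toℕ i) r)))
    where
    i≢j : i ≢ j
    i≢j ≡.refl = ℕ.<⇒≢ (ℕ.m<m+n (toℕ i) 1≤r) j≡i+r

  -- Minimum skew ranks of path powers.

  module PathBand {r k : ℕ} (1≤r : 1 ℕ.≤ r) {A : Matrix (r ℕ.+ k) (r ℕ.+ k)}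
    (A∈S : InSkew (pathPower (r ℕ.+ k) r) A) =
    Band r k A (proj₁ A∈S) (InSkew⇒outside A∈S) (InSkew⇒edge 1≤r A∈S)

  -- The triangular minor has the size n - r = 2q + 2, which is also the rank bound of the
  -- construction with q + 1 windows.
  minSkewRank-even : ∀ {n r} q → 1 ℕ.≤ r → n ≡ r ℕ.+ suc q ℕ.* 2 →
    MinSkewRankIs (pathPower n r) (suc q ℕ.* 2)
  minSkewRank-even {r = r} q 1≤r ≡.refl =
    (A , A∈S , PathBand.minor-k 1≤r A∈S , no-large-minor) ,
    λ _ _ B∈S (_ , max) → ℕ.≮⇒≥ λ k< → max _ k< (PathBand.minor-k 1≤r B∈S)
    where
    open Construction (suc q) r (r ℕ.+ suc q ℕ.* 2)
    A∈S = Construction-InSkew q r _ (ℕ.≤-reflexive (ℕ.+-comm r (suc q ℕ.* 2)))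

  -- As n - r = 2q + 1 is odd, A[g,g] is singular, which yields a nonzero minor of size 2q + 2.
  minSkewRank-odd : ∀ {n r} q → 1 ℕ.≤ r → n ≡ r ℕ.+ suc (q ℕ.* 2) →
    MinSkewRankIs (pathPower n r) (suc q ℕ.* 2)
  minSkewRank-odd {r = r} q 1≤r ≡.refl =
    (A , A∈S , minor A∈S , no-large-minor) ,
    λ _ _ B∈S (_ , max) → ℕ.≮⇒≥ λ k< → max _ k< (minor B∈S)
    where
    open Construction (suc q) r (r ℕ.+ suc (q ℕ.* 2))
    -- The last window extends one index past the end of the path.
    A∈S = Construction-InSkew q r _ (ℕ.≤-trans (ℕ.≤-reflexive (ℕ.+-comm r _)) (ℕ.n≤1+n _))
    minor : ∀ {B} → InSkew (pathPower (r ℕ.+ suc (q ℕ.* 2)) r) B → HasNonzeroMinor B (suc q ℕ.* 2)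
    minor B∈S = PathBand.minor-suc-k 1≤r B∈S (odd-skew⇒kernel q _ λ i j → proj₁ B∈S _ _)

  -- Graphs are type-valued relations, so a change of exponent has to be transported along mutual
  -- implications between the edge relations.
  MinSkewRankIs-resp : ∀ {n m} {G H : Graph n} → (∀ i j → G i j → H i j) → (∀ i j → H i j → G i j) →
    MinSkewRankIs G m → MinSkewRankIs H m
  MinSkewRankIs-resp G⊆H H⊆G ((A , A∈S , rank) , minimal) =
    (A , transport G⊆H H⊆G A∈S , rank) , λ B k B∈S → minimal B k (transport H⊆G G⊆H B∈S)
    where
    transport : ∀ {G H B} → (∀ i j → G i j → H i j) → (∀ i j → H i j → G i j) → InSkew G B → InSkew H B
    transport G⊆H H⊆G (skew , pattern′) = skew , λ i j i≢j →
      (λ ≉0 → G⊆H i j (proj₁ (pattern′ i j i≢j) ≉0)) , λ h → proj₂ (pattern′ i j i≢j) (H⊆G i j h)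

  -- All distances among n + 1 vertices are at most n, so the exponent may be lowered to n. This is
  -- the odd case with difference 1.
  minSkewRank-complete : ∀ n r → n ℕ.≤ r → 1 ℕ.≤ n → MinSkewRankIs (pathPower (suc n) r) 2
  minSkewRank-complete n r n≤r 1≤n = MinSkewRankIs-resp
    (λ i j (i≢j , d≤) → i≢j , ℕ.≤-trans d≤ n≤r)
    (λ i j (i≢j , _) → i≢j , ℕ.≤-trans (ℕ.∣m-n∣≤m⊔n (toℕ i) (toℕ j)) (ℕ.⊔-lub (Fin.toℕ≤pred[n] i) (Fin.toℕ≤pred[n] j)))
    (minSkewRank-odd 0 1≤n (ℕ.+-comm 1 n))

-- Assembling the three cases.

parity : ∀ k → ∃ λ q → k ≡ q ℕ.* 2 ⊎ k ≡ suc (q ℕ.* 2)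
parity zero = 0 , inj₁ ≡.refl
parity (suc k) with parity k
... | q , inj₁ e = q , inj₂ (≡.cong suc e)
... | q , inj₂ e = suc q , inj₁ (≡.cong suc e)

open import Data.Nat using (_+_; _∸_; _≤_)

mainTheorem1 : (R : RealField) → (n r : ℕ) → 4 ≤ n → 1 ≤ r →
    let open Matrices R in
    ((r ≤ n ∸ 3 → 2 ∣ (n ∸ r) → MinSkewRankIs (pathPower n r) (n ∸ r)) ×
    (r ≤ n ∸ 3 → ¬ (2 ∣ (n ∸ r)) → MinSkewRankIs (pathPower n r) (n ∸ r + 1)) ×
    (n ∸ 2 ≤ r → MinSkewRankIs (pathPower n r) 2))
mainTheorem1 R n@(suc n-1) r 4≤n 1≤r = even , odd , large
  where
  open Matrices R

  r<n : r ≤ n ∸ 3 → r ℕ.< n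
  r<n r≤n∸3 = s≤s (ℕ.≤-trans r≤n∸3 (ℕ.m∸n≤m n-1 2))

  n≡r+ : ∀ {k} → r ≤ n ∸ 3 → n ∸ r ≡ k → n ≡ r + k
  n≡r+ r≤n∸3 e = ≡.trans (≡.sym (ℕ.m+[n∸m]≡n (ℕ.<⇒≤ (r<n r≤n∸3)))) (≡.cong (r +_) e)

  even : r ≤ n ∸ 3 → 2 ∣ (n ∸ r) → MinSkewRankIs (pathPower n r) (n ∸ r)
  even r≤n∸3 (divides zero e)    = contradiction e (ℕ.m>n⇒m∸n≢0 (r<n r≤n∸3))
  even r≤n∸3 (divides (suc q) e) = ≡.subst (MinSkewRankIs (pathPower n r)) (≡.sym e)
    (minSkewRank-even R q 1≤r (n≡r+ r≤n∸3 e))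

  odd : r ≤ n ∸ 3 → ¬ (2 ∣ (n ∸ r)) → MinSkewRankIs (pathPower n r) (n ∸ r + 1)
  odd r≤n∸3 2∤n∸r with parity (n ∸ r)
  ... | q , inj₁ e = contradiction (divides q e) 2∤n∸r
  ... | q , inj₂ e = ≡.subst (MinSkewRankIs (pathPower n r))
    (≡.trans (≡.cong suc (≡.sym e)) (ℕ.+-comm 1 (n ∸ r)))
    (minSkewRank-odd R q 1≤r (n≡r+ r≤n∸3 e))

  large : n ∸ 2 ≤ r → MinSkewRankIs (pathPower n r) 2
  -- For r = n - 2 the difference n - r is 2, an instance of the even case; for larger `r` the graph
  -- is complete.
  large n∸2≤r with ℕ.m≤n⇒m<n∨m≡n n∸2≤r
  ... | inj₂ ≡.refl = minSkewRank-even R 0 1≤r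
    (≡.sym (ℕ.m∸n+n≡m {n} {2} (ℕ.≤-trans (s≤s (s≤s z≤n)) 4≤n)))
  ... | inj₁ n∸2<r  = minSkewRank-complete R n-1 r
    (≡.subst (_≤ r) (ℕ.m+[n∸m]≡n {1} 1≤n-1) n∸2<r) 1≤n-1
    where
    1≤n-1 : 1 ≤ n-1
    1≤n-1 = ℕ.≤-trans (s≤s z≤n) (ℕ.s≤s⁻¹ 4≤n)
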